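{- Let $T=\{1432,2143,3214\}$ and let $F_T(x)=\sum_{n\ge0}|S_n(T)|x^n$. Then $$F_T(x)=\frac{(1-x)^4(1-6x+12x^2-9x^3+x^4)}{1-11x+51x^2-132x^3+209x^4-208x^5+128x^6-44x^7+5x^8}.$$
   Context: $S_n$ is the set of permutations of $[n]$ ($S_0$ contains the empty permutation). A permutation avoids a pattern $\tau$ if it has no subsequence order-isomorphic to $\tau$; $S_n(T)$ is the set of permutations in $S_n$ avoiding every pattern in $T$. -}

module Defs where

open import Data.Nat using (ℕ; zero; suc; _∸_)
open import Data.Integer as ℤ using (ℤ; +_; -_)
open import Data.Fin using (Fin; zero; suc)
open import Data.Fin as F using ()
open import Data.Vec using (Vec; []; _∷_; lookup)
open import Data.List using (List; []; _∷_; length)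
open import Data.List.Membership.Propositional using (_∈_)
open import Data.List.Relation.Unary.Unique.Propositional using (Unique)
open import Data.Product using (Σ; _×_; ∃)
open import Function.Bundles using (_⇔_)
open import Relation.Binary.PropositionalEquality using (_≡_)
open import Relation.Nullary using (¬_)

-- A permutation of [n] in one-line notation, values shifted to 0..n-1:
-- a word w of length n over Fin n with pairwise distinct entries.
IsPerm : ∀ {n} → Vec (Fin n) n → Set
IsPerm {n} w = ∀ (i j : Fin n) → lookup w i ≡ lookup w j → i ≡ j

Contains : ∀ {n k} → Vec (Fin n) n → Vec (Fin k) k → Set
Contains {n} {k} w τ =
  Σ (Fin k → Fin n) λ ι →
    (∀ (a b : Fin k) → a F.< b → ι a F.< ι b) ×
    (∀ (a b : Fin k) → (lookup τ a F.< lookup τ b) ⇔ (lookup w (ι a) F.< lookup w (ι b)))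

Avoids : ∀ {n k} → Vec (Fin n) n → Vec (Fin k) k → Set
Avoids w τ = ¬ Contains w τ

-- The patterns 1432, 2143, 3214 (values shifted down by one).
p1432 p2143 p3214 : Vec (Fin 4) 4
p1432 = zero ∷ suc (suc (suc zero)) ∷ suc (suc zero) ∷ suc zero ∷ []
p2143 = suc zero ∷ zero ∷ suc (suc (suc zero)) ∷ suc (suc zero) ∷ []
p3214 = suc (suc zero) ∷ suc zero ∷ zero ∷ suc (suc (suc zero)) ∷ []

InSnT : ∀ n → Vec (Fin n) n → Set
InSnT n w = IsPerm w × Avoids w p1432 × Avoids w p2143 × Avoids w p3214

HasSize : {A : Set} → (A → Set) → ℕ → Set
HasSize {A} P k =
  Σ (List A) λ L → Unique L × (∀ x → (x ∈ L) ⇔ P x) × (length L ≡ k)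

Series : Set
Series = ℕ → ℤ

sumTo : ℕ → (ℕ → ℤ) → ℤ
sumTo zero h = h 0
sumTo (suc n) h = sumTo n h ℤ.+ h (suc n)

_⊛_ : Series → Series → Series
(f ⊛ g) n = sumTo n (λ k → f k ℤ.* g (n ∸ k))

infixl 7 _⊛_

-- polynomial from its coefficient list (constant term first)
poly : List ℤ → Series
poly [] n = + 0
poly (c ∷ cs) zero = c
poly (c ∷ cs) (suc n) = poly cs n

pow : Series → ℕ → Series
pow f zero = poly (+ 1 ∷ [])
pow f (suc k) = f ⊛ pow f k

gf : (ℕ → ℕ) → Series
gf a n = + (a n)

numer : Series
numer = pow (poly (+ 1 ∷ - (+ 1) ∷ [])) 4
      ⊛ poly (+ 1 ∷ - (+ 6) ∷ + 12 ∷ - (+ 9) ∷ + 1 ∷ [])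

denom : Series
denom = poly (+ 1 ∷ - (+ 11) ∷ + 51 ∷ - (+ 132) ∷ + 209 ∷ - (+ 208)
              ∷ + 128 ∷ - (+ 44) ∷ + 5 ∷ [])

{-# OPTIONS --safe #-}
module Submission where

-- Permutations are built by inserting the maximum.  The admissible insertion sites of a word form a
-- short left part 0 < ms < m, in front of which the word is increasing, and a right part; which of
-- them survive the next insertion depends only on two comparisons per right site.  Hence the number
-- of descendants of a word is determined by the shape of its site list, and only the shapes
--   Z k,  B a k = A a ⊤ (⊤⊤)ᵏ,  C a k = A a ⊥ (⊤⊤)(⊥⊤)ᵏ,  D a k = A a ⊥ (⊥⊤)ᵏ⁺¹,
--   M k = A 0 ⊥ (⊤⊥)ᵏ(⊤⊤),  E k = A 0 ⊥ (⊤⊥)ᵏ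
-- occur.  Their counts satisfy recurrences in which the parameters a and k enter through first
-- differences, so after summing over the parameters along diagonals one is left with 23 integer
-- sequences closed under a linear recursion; the asserted identity is then a linear functional
-- that this recursion annihilates.

-- Once n has been inserted, the next maximum can meet it only as the 3 of a pattern. In 3214 the 3
-- precedes the 4, in 2143 and 1432 it follows; so a site behind n needs the letters between n and
-- itself to increase, and a site in front of n needs an increasing prefix whose letters exceed
-- those behind n. Left sites therefore live or die almost as a block, which keeps the list of
-- shapes short. In the count the obstacle is `b`: the child B (a+1) k of B a k does not lower any
-- parameter. But along this chain a advances with the generation, so unrolling it turns the
-- recurrence into a sum along a diagonal; and among the terms so collected, the sum of
-- `b 0 (suc a)` over a is the diagonal sum of the row a = 0 itself. Hence only this row occurs in
-- the final system. First differences in k remove the remaining sums over children, at the price of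
-- carrying a family together with its shift by one, which is why 23 sequences stand behind a
-- denominator of degree 8.

open import Defs
open import Data.Bool using (Bool; true; false)
open import Data.Empty using (⊥; ⊥-elim)
open import Data.Fin as F using (Fin; toℕ; fromℕ; fromℕ<; inject₁; punchOut; #_)
open import Data.Fin.Patterns using (0F; 1F; 2F; 3F)
import Data.Fin.Properties as F
open import Data.Integer using (ℤ; +_; _+_; _-_; _*_)
open import Data.Integer.Properties as ℤ using (+-assoc; +-identityˡ; +-identityʳ)
open import Data.Integer.Tactic.RingSolver using (solve-∀)
open import Data.List using (List; []; _∷_; _∷ʳ_; map; _++_; concatMap; length; replicate)
open import Data.List.Membership.Propositional using (_∈_)
open import Data.List.Membership.Propositional.Properties using (∈-map⁺; ∈-map⁻; ∈-++⁺ˡ; ∈-++⁺ʳ; ∈-++⁻; ∈-concatMap⁺)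
open import Data.List.Properties using (map-id; map-∘; map-++; map-cong; map-replicate; length-map; length-replicate)
open import Data.List.Relation.Unary.All as All using (All; []; _∷_)
import Data.List.Relation.Unary.All.Properties as All
open import Data.List.Relation.Unary.AllPairs as AllPairs using (AllPairs; []; _∷_)
import Data.List.Relation.Unary.AllPairs.Properties as AllPairs
open import Data.List.Relation.Unary.Any as Any using (here; there)
open import Data.Nat as ℕ using (ℕ; zero; suc; _∸_; _≤_; _<_; z≤n; s≤s; z<s; s<s)
open import Data.Nat.Properties as ℕ hiding (+-assoc; +-identityˡ; +-identityʳ)
open import Data.Product using (Σ; _×_; _,_; proj₁; proj₂; ∃)
open import Data.Sum using (_⊎_; inj₁; inj₂)
open import Data.Vec as Vec using (Vec; []; _∷_; lookup; tabulate; zipWith)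
open import Data.Vec.Properties using (≡-dec)
open import Data.Vec.Relation.Binary.Pointwise.Inductive using (Pointwise; []; _∷_)
open import Function using (_∘_; id; const)
open import Function.Bundles using (_⇔_; mk⇔; Equivalence)
open import Relation.Binary using (tri<; tri≈; tri>)
open import Relation.Binary.PropositionalEquality using (_≡_; _≢_; refl; sym; trans; cong; cong₂; subst; subst₂; module ≡-Reasoning)
open import Relation.Nullary using (¬_; yes; no)
open import Relation.Nullary.Decidable using (from-yes)

-- Inserting a new maximum

-- The position, after a letter has been inserted at position p, of the letter formerly at position i.
up : ℕ → ℕ → ℕ
up zero    i       = suc i
up (suc p) zero    = zero
up (suc p) (suc i) = suc (up p i)

data Position (p : ℕ) : ℕ → Set where
  new : Position p p
  old : ∀ i → Position p (up p i)

position : ∀ p j → Position p j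
position zero    zero    = new
position zero    (suc j) = old j
position (suc p) zero    = old zero
position (suc p) (suc j) with position p j
... | new   = new
... | old i = old (suc i)

up-mono-< : ∀ p {i j} → i < j → up p i < up p j
up-mono-< zero    i<j = s<s i<j
up-mono-< (suc p) {zero}  {suc j} _         = z<s
up-mono-< (suc p) {suc i} {suc j} (s<s i<j) = s<s (up-mono-< p i<j)

up-cancel-< : ∀ p {i j} → up p i < up p j → i < j
up-cancel-< zero    (s<s i<j) = i<j
up-cancel-< (suc p) {zero}  {suc j} _       = z<s
up-cancel-< (suc p) {suc i} {suc j} (s<s h) = s<s (up-cancel-< p h)

-- In these bounds q is a site: a site q ≤ p keeps its number when a letter enters at p, a site q ≥
-- p becomes `suc q`. The two cases overlap at q = p because that gap splits in two.
up-<ˡ : ∀ {p q i} → q ≤ p → i < q → up p i < q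
up-<ˡ {suc p} {suc q} {zero}  _         _         = z<s
up-<ˡ {suc p} {suc q} {suc i} (s≤s q≤p) (s<s i<q) = s<s (up-<ˡ q≤p i<q)

up-<ˡ⁻¹ : ∀ {p q i} → q ≤ p → up p i < q → i < q
up-<ˡ⁻¹ {suc p} {suc q} {zero}  _         _       = z<s
up-<ˡ⁻¹ {suc p} {suc q} {suc i} (s≤s q≤p) (s<s h) = s<s (up-<ˡ⁻¹ q≤p h)

up-<ʳ : ∀ {p q i} → p ≤ q → i < q → up p i < suc q
up-<ʳ {zero}                  _         i<q       = s<s i<q
up-<ʳ {suc p} {suc q} {zero}  _         _         = z<s
up-<ʳ {suc p} {suc q} {suc i} (s≤s p≤q) (s<s i<q) = s<s (up-<ʳ p≤q i<q)

up-<ʳ⁻¹ : ∀ {p q i} → p ≤ q → up p i < suc q → i < q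
up-<ʳ⁻¹ {zero}                  _         (s<s h) = h
up-<ʳ⁻¹ {suc p} {suc q} {zero}  _         _       = z<s
up-<ʳ⁻¹ {suc p} {suc q} {suc i} (s≤s p≤q) (s<s h) = s<s (up-<ʳ⁻¹ p≤q h)

up-≥ˡ : ∀ {p q i} → q ≤ p → q ≤ i → q ≤ up p i
up-≥ˡ q≤p q≤i = ≮⇒≥ λ h → <⇒≱ (up-<ˡ⁻¹ q≤p h) q≤i

up-≥ˡ⁻¹ : ∀ {p q i} → q ≤ p → q ≤ up p i → q ≤ i
up-≥ˡ⁻¹ q≤p h = ≮⇒≥ λ i<q → <⇒≱ (up-<ˡ q≤p i<q) h

up-≥ʳ : ∀ {p q i} → p ≤ q → q ≤ i → suc q ≤ up p i
up-≥ʳ p≤q q≤i = ≮⇒≥ λ h → <⇒≱ (up-<ʳ⁻¹ p≤q h) q≤i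

up-≥ʳ⁻¹ : ∀ {p q i} → p ≤ q → suc q ≤ up p i → q ≤ i
up-≥ʳ⁻¹ p≤q h = ≮⇒≥ λ i<q → <⇒≱ (up-<ʳ p≤q i<q) h

-- A word of length n is a function on ℕ of which only the values at 0..n-1 matter; the site q is
-- the gap in front of position q.  A site is active when a new maximum inserted there creates
-- none of 3214, 2143 and 1432 (in this order below).
record Active (n : ℕ) (f : ℕ → ℕ) (q : ℕ) : Set where
  constructor active
  field
    no321 : ∀ {i j k} → i < j → j < k → k < q → f j < f i → f k < f j → ⊥
    no213 : ∀ {i j k} → i < j → j < q → q ≤ k → k < n → f j < f i → f k ≤ f i
    no132 : ∀ {i j k} → i < q → q ≤ j → j < k → k < n → f k < f j → f k ≤ f i

-- The weak inequality makes this exactly the absence of an inversion, so that `≮⇒≥` and `<⇒≱`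
-- convert between the two for any word.
Inc : (ℕ → ℕ) → ℕ → ℕ → Set
Inc f p q = ∀ {i j} → p ≤ i → i < j → j < q → f i ≤ f j

Above : ℕ → (ℕ → ℕ) → ℕ → ℕ → Set
Above n f q p = ∀ {i j} → i < q → p ≤ j → j < n → f j ≤ f i

record Avoiding (n : ℕ) (f : ℕ → ℕ) : Set where
  constructor avoiding
  field
    no1432 : ∀ {i j k l} → i < j → j < k → k < l → l < n → f i < f l → f l < f k → f k < f j → ⊥
    no2143 : ∀ {i j k l} → i < j → j < k → k < l → l < n → f j < f i → f i < f l → f l < f k → ⊥
    no3214 : ∀ {i j k l} → i < j → j < k → k < l → l < n → f k < f j → f j < f i → f i < f l → ⊥

-- g is the word obtained from f by inserting the new maximum n at the site p.
module Insertion {n p : ℕ} {f g : ℕ → ℕ} (p≤n : p ≤ n)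
                 (f<n : ∀ {i} → i < n → f i < n)
                 (g-new : g p ≡ n) (g-old : ∀ i → g (up p i) ≡ f i) where

  private
    lift< : ∀ {i j} → f i < f j → g (up p i) < g (up p j)
    lift< {i} {j} = subst₂ _<_ (sym (g-old i)) (sym (g-old j))

    lower< : ∀ {i j} → g (up p i) < g (up p j) → f i < f j
    lower< {i} {j} = subst₂ _<_ (g-old i) (g-old j)

    lift≤ : ∀ {i j} → f i ≤ f j → g (up p i) ≤ g (up p j)
    lift≤ {i} {j} = subst₂ _≤_ (sym (g-old i)) (sym (g-old j))

    lower≤ : ∀ {i j} → g (up p i) ≤ g (up p j) → f i ≤ f j
    lower≤ {i} {j} = subst₂ _≤_ (g-old i) (g-old j)

    below-new : ∀ {i} → up p i < suc n → g (up p i) < g p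
    below-new {i} h = subst₂ _<_ (sym (g-old i)) (sym g-new) (f<n (up-<ʳ⁻¹ p≤n h))

    new-max : ∀ {i} → up p i < suc n → ¬ (g p ≤ g (up p i))
    new-max h = <⇒≱ (below-new h)

    below-new′ : ∀ {i} → i < n → g (up p i) < g p
    below-new′ i<n = below-new (up-<ʳ p≤n i<n)

    new≮ : ∀ {i} → up p i < suc n → ¬ (g p < g (up p i))
    new≮ h h′ = new-max h (<⇒≤ h′)

  -- Behind the site, the new letter can be the 3 of 2143, which takes an inversion in front of q
  -- and is excluded by `Inc f 0 q`, or the 3 of 1432, which takes a letter in front of q smaller
  -- than one behind p and is excluded by `Above n f q p`.
  active-left : ∀ {q} → q ≤ p → Active n f q → Inc f 0 q → Above n f q p → Active (suc n) g q
  active-left {q} q≤p (active _ _ no132) inc above = active c1 c2 c3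
    where
    c1 : ∀ {i j k} → i < j → j < k → k < q → g j < g i → g k < g j → ⊥
    c1 {i} {j} {k} i<j j<k k<q gj<gi _ with position p i | position p j
    ... | new | _ = <-irrefl refl (<-≤-trans (<-trans i<j (<-trans j<k k<q)) q≤p)
    ... | _ | new = <-irrefl refl (<-≤-trans (<-trans j<k k<q) q≤p)
    ... | old i | old j =
      <⇒≱ (lower< gj<gi) (inc z≤n (up-cancel-< p i<j) (up-<ˡ⁻¹ q≤p (<-trans j<k k<q)))
    c2 : ∀ {i j k} → i < j → j < q → q ≤ k → k < suc n → g j < g i → g k ≤ g i
    c2 {i} {j} i<j j<q _ _ gj<gi with position p i | position p j
    ... | new | _ = ⊥-elim (<-irrefl refl (<-≤-trans (<-trans i<j j<q) q≤p))
    ... | _ | new = ⊥-elim (<-irrefl refl (<-≤-trans j<q q≤p))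
    ... | old i | old j =
      ⊥-elim (<⇒≱ (lower< gj<gi) (inc z≤n (up-cancel-< p i<j) (up-<ˡ⁻¹ q≤p j<q)))
    c3 : ∀ {i j k} → i < q → q ≤ j → j < k → k < suc n → g k < g j → g k ≤ g i
    c3 {i} {j} {k} i<q q≤j j<k k<n gk<gj with position p i | position p j | position p k
    ... | new | _ | _ = ⊥-elim (<-irrefl refl (<-≤-trans i<q q≤p))
    ... | old i | old j | new = ⊥-elim (new≮ (<-trans j<k k<n) gk<gj)
    ... | old i | new | new = ⊥-elim (<-irrefl refl j<k)
    ... | old i | new | old k =
      lift≤ (above (up-<ˡ⁻¹ q≤p i<q) (up-≥ʳ⁻¹ ≤-refl j<k) (up-<ʳ⁻¹ p≤n k<n))
    ... | old i | old j | old k =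
      lift≤ (no132 (up-<ˡ⁻¹ q≤p i<q) (up-≥ˡ⁻¹ q≤p q≤j) (up-cancel-< p j<k) (up-<ʳ⁻¹ p≤n k<n) (lower< gk<gj))

  active-left⁻¹ : ∀ {q} → q ≤ p → Active (suc n) g q → Active n f q × Inc f 0 q × Above n f q p
  active-left⁻¹ {q} q≤p (active no321 no213 no132) =
    active
      (λ i<j j<k k<q fj<fi fk<fj →
        no321 (up-mono-< p i<j) (up-mono-< p j<k) (up-<ˡ q≤p k<q) (lift< fj<fi) (lift< fk<fj))
      (λ i<j j<q q≤k k<n fj<fi →
        lower≤ (no213 (up-mono-< p i<j) (up-<ˡ q≤p j<q) (up-≥ˡ q≤p q≤k) (up-<ʳ p≤n k<n) (lift< fj<fi)))
      (λ i<q q≤j j<k k<n fk<fj →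
        lower≤ (no132 (up-<ˡ q≤p i<q) (up-≥ˡ q≤p q≤j) (up-mono-< p j<k) (up-<ʳ p≤n k<n) (lift< fk<fj))) ,
    (λ _ i<j j<q → ≮⇒≥ λ fj<fi →
      new-max (up-<ʳ p≤n (<-≤-trans (<-trans i<j j<q) (≤-trans q≤p p≤n)))
        (no213 (up-mono-< p i<j) (up-<ˡ q≤p j<q) q≤p (s≤s p≤n) (lift< fj<fi))) ,
    (λ i<q p≤j j<n →
      lower≤ (no132 (up-<ˡ q≤p i<q) q≤p (up-≥ʳ ≤-refl p≤j) (up-<ʳ p≤n j<n) (below-new′ j<n)))

  -- A pattern using both the new letter and the next maximum would need its 3 immediately in front
  -- of its 4, and none of 1432, 2143, 3214 has this factor.
  active-new : Active n f p → Active (suc n) g (suc p)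
  active-new (active no321 no213 no132) = active c1 c2 c3
    where
    c1 : ∀ {i j k} → i < j → j < k → k < suc p → g j < g i → g k < g j → ⊥
    c1 {i} {j} {k} i<j j<k k<p gj<gi gk<gj with position p i | position p j | position p k
    ... | new | _ | _ = <-irrefl refl (<-≤-trans (<-trans i<j j<k) (≤-pred k<p))
    ... | _ | new | _ = <-irrefl refl (<-≤-trans j<k (≤-pred k<p))
    ... | old i | old j | new = new≮ (<-trans j<k (<-≤-trans k<p (s≤s p≤n))) gk<gj
    ... | old i | old j | old k =
      no321 (up-cancel-< p i<j) (up-cancel-< p j<k) (up-<ʳ⁻¹ ≤-refl k<p) (lower< gj<gi) (lower< gk<gj)
    c2 : ∀ {i j k} → i < j → j < suc p → suc p ≤ k → k < suc n → g j < g i → g k ≤ g i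
    c2 {i} {j} {k} i<j j<p p<k k<n gj<gi with position p i | position p j | position p k
    ... | new | _ | _ = ⊥-elim (<-irrefl refl (<-≤-trans i<j (≤-pred j<p)))
    ... | old i | new | _ = ⊥-elim (new≮ (<-trans i<j (<-≤-trans j<p (s≤s p≤n))) gj<gi)
    ... | _ | _ | new = ⊥-elim (<-irrefl refl p<k)
    ... | old i | old j | old k =
      lift≤ (no213 (up-cancel-< p i<j) (up-<ʳ⁻¹ ≤-refl j<p) (up-≥ʳ⁻¹ ≤-refl p<k) (up-<ʳ⁻¹ p≤n k<n) (lower< gj<gi))
    c3 : ∀ {i j k} → i < suc p → suc p ≤ j → j < k → k < suc n → g k < g j → g k ≤ g i
    c3 {i} {j} {k} i<p p<j j<k k<n gk<gj with position p i | position p j | position p k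
    ... | _ | new | _ = ⊥-elim (<-irrefl refl p<j)
    ... | _ | _ | new = ⊥-elim (<-asym p<j j<k)
    ... | new | old j | old k = <⇒≤ (below-new k<n)
    ... | old i | old j | old k =
      lift≤ (no132 (up-<ʳ⁻¹ ≤-refl i<p) (up-≥ʳ⁻¹ ≤-refl p<j) (up-cancel-< p j<k) (up-<ʳ⁻¹ p≤n k<n) (lower< gk<gj))

  -- In front of the site, the new letter can only be the 3 of 3214; the 2 and the 1 would be an
  -- inversion between p and q.
  active-right : ∀ {q} → p < q → q ≤ n → Active n f q → Inc f p q → Active (suc n) g (suc q)
  active-right {q} p<q q≤n (active no321 no213 no132) inc = active c1 c2 c3
    where
    p≤q = <⇒≤ p<q
    c1 : ∀ {i j k} → i < j → j < k → k < suc q → g j < g i → g k < g j → ⊥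
    c1 {i} {j} {k} i<j j<k k<q gj<gi gk<gj with position p i | position p j | position p k
    ... | new | new | _ = <-irrefl refl i<j
    ... | _ | new | new = <-irrefl refl j<k
    ... | new | old j | new = <-asym i<j j<k
    ... | new | old j | old k =
      <⇒≱ (lower< gk<gj) (inc (up-≥ʳ⁻¹ ≤-refl i<j) (up-cancel-< p j<k) (up-<ʳ⁻¹ p≤q k<q))
    ... | old i | new | old k = new≮ (<-trans i<j (<-≤-trans (<-trans j<k k<q) (s≤s q≤n))) gj<gi
    ... | old i | old j | new = new≮ (<-trans j<k (s≤s p≤n)) gk<gj
    ... | old i | old j | old k =
      no321 (up-cancel-< p i<j) (up-cancel-< p j<k) (up-<ʳ⁻¹ p≤q k<q) (lower< gj<gi) (lower< gk<gj)
    c2 : ∀ {i j k} → i < j → j < suc q → suc q ≤ k → k < suc n → g j < g i → g k ≤ g i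
    c2 {i} {j} {k} i<j j<q q<k k<n gj<gi with position p i | position p j | position p k
    ... | _ | _ | new = ⊥-elim (<-asym p<q q<k)
    ... | new | _ | old k = <⇒≤ (below-new k<n)
    ... | old i | new | _ = ⊥-elim (new≮ (<-trans i<j (s≤s p≤n)) gj<gi)
    ... | old i | old j | old k =
      lift≤ (no213 (up-cancel-< p i<j) (up-<ʳ⁻¹ p≤q j<q) (up-≥ʳ⁻¹ p≤q q<k) (up-<ʳ⁻¹ p≤n k<n) (lower< gj<gi))
    c3 : ∀ {i j k} → i < suc q → suc q ≤ j → j < k → k < suc n → g k < g j → g k ≤ g i
    c3 {i} {j} {k} i<q q<j j<k k<n gk<gj with position p i | position p j | position p k
    ... | _ | new | _ = ⊥-elim (<-asym p<q q<j)
    ... | _ | _ | new = ⊥-elim (<-asym p<q (<-trans q<j j<k))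
    ... | new | old j | old k = <⇒≤ (below-new k<n)
    ... | old i | old j | old k =
      lift≤ (no132 (up-<ʳ⁻¹ p≤q i<q) (up-≥ʳ⁻¹ p≤q q<j) (up-cancel-< p j<k) (up-<ʳ⁻¹ p≤n k<n) (lower< gk<gj))

  active-right⁻¹ : ∀ {q} → p ≤ q → q ≤ n → Active (suc n) g (suc q) → Active n f q × Inc f p q
  active-right⁻¹ {q} p≤q q≤n (active no321 no213 no132) =
    active
      (λ i<j j<k k<q fj<fi fk<fj →
        no321 (up-mono-< p i<j) (up-mono-< p j<k) (up-<ʳ p≤q k<q) (lift< fj<fi) (lift< fk<fj))
      (λ i<j j<q q≤k k<n fj<fi →
        lower≤ (no213 (up-mono-< p i<j) (up-<ʳ p≤q j<q) (up-≥ʳ p≤q q≤k) (up-<ʳ p≤n k<n) (lift< fj<fi)))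
      (λ i<q q≤j j<k k<n fk<fj →
        lower≤ (no132 (up-<ʳ p≤q i<q) (up-≥ʳ p≤q q≤j) (up-mono-< p j<k) (up-<ʳ p≤n k<n) (lift< fk<fj))) ,
    (λ p≤i i<j j<q → ≮⇒≥ λ fj<fi →
      no321 (up-≥ʳ ≤-refl p≤i) (up-mono-< p i<j) (up-<ʳ p≤q j<q)
            (below-new′ (<-≤-trans (<-trans i<j j<q) q≤n)) (lift< fj<fi))

  inc-left : ∀ {q r} → r ≤ p → Inc f q r → Inc g q r
  inc-left {q} {r} r≤p inc {i} {j} q≤i i<j j<r with position p i | position p j
  ... | new | _ = ⊥-elim (<-irrefl refl (<-≤-trans (<-trans i<j j<r) r≤p))
  ... | _ | new = ⊥-elim (<-irrefl refl (<-≤-trans j<r r≤p))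
  ... | old i | old j =
    lift≤ (inc (up-≥ˡ⁻¹ (≤-trans (≤-trans q≤i (<⇒≤ (<-trans i<j j<r))) r≤p) q≤i) (up-cancel-< p i<j) (up-<ˡ⁻¹ r≤p j<r))

  inc-new : ∀ {q} → q ≤ p → Inc f q p → Inc g q (suc p)
  inc-new {q} q≤p inc {i} {j} q≤i i<j j<p with position p i | position p j
  ... | new | _ = ⊥-elim (<-irrefl refl (<-≤-trans i<j (≤-pred j<p)))
  ... | old i | new = <⇒≤ (below-new (<-trans i<j (s≤s p≤n)))
  ... | old i | old j = lift≤ (inc (up-≥ˡ⁻¹ q≤p q≤i) (up-cancel-< p i<j) (up-<ʳ⁻¹ ≤-refl j<p))

  inc-new⁻¹ : ∀ {q} → q ≤ p → Inc g q (suc p) → Inc f q p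
  inc-new⁻¹ q≤p inc q≤i i<j j<p =
    lower≤ (inc (up-≥ˡ q≤p q≤i) (up-mono-< p i<j) (up-<ʳ ≤-refl j<p))

  inc-right : ∀ {q r} → p ≤ q → Inc f q r → Inc g (suc q) (suc r)
  inc-right {q} {r} p≤q inc {i} {j} q<i i<j j<r with position p i | position p j
  ... | new | _ = ⊥-elim (<⇒≱ q<i p≤q)
  ... | _ | new = ⊥-elim (<⇒≱ (<-trans q<i i<j) p≤q)
  ... | old i | old j =
    lift≤ (inc (up-≥ʳ⁻¹ p≤q q<i) (up-cancel-< p i<j)
               (up-<ʳ⁻¹ (≤-trans p≤q (<⇒≤ (≤-pred (<-trans (≤-<-trans q<i i<j) j<r)))) j<r))

  not-inc-across : ∀ {q r} → q ≤ p → p < r → r ≤ n → ¬ Inc g q (suc r)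
  not-inc-across q≤p p<r r≤n inc =
    new-max (up-<ʳ p≤n (<-≤-trans p<r r≤n)) (inc q≤p (up-≥ʳ ≤-refl ≤-refl) (up-<ʳ (<⇒≤ p<r) p<r))

  above-left : ∀ {q r} → q ≤ p → p ≤ r → Above n f q r → Above (suc n) g q (suc r)
  above-left q≤p p≤r above {i} {j} i<q r<j j<n with position p i | position p j
  ... | new | _ = ⊥-elim (<⇒≱ i<q q≤p)
  ... | _ | new = ⊥-elim (<⇒≱ r<j p≤r)
  ... | old i | old j = lift≤ (above (up-<ˡ⁻¹ q≤p i<q) (up-≥ʳ⁻¹ p≤r r<j) (up-<ʳ⁻¹ p≤n j<n))

  above-left⁻¹ : ∀ {q r} → q ≤ p → p ≤ r → Above (suc n) g q (suc r) → Above n f q r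
  above-left⁻¹ q≤p p≤r above i<q r≤j j<n = lower≤ (above (up-<ˡ q≤p i<q) (up-≥ʳ p≤r r≤j) (up-<ʳ p≤n j<n))

  above-new : ∀ {r} → p ≤ r → Above n f p r → Above (suc n) g (suc p) (suc r)
  above-new p≤r above {i} {j} i<p r<j j<n with position p i | position p j
  ... | _ | new = ⊥-elim (<⇒≱ r<j p≤r)
  ... | new | old j = <⇒≤ (below-new j<n)
  ... | old i | old j = lift≤ (above (up-<ʳ⁻¹ ≤-refl i<p) (up-≥ʳ⁻¹ p≤r r<j) (up-<ʳ⁻¹ p≤n j<n))

  above-new⁻¹ : ∀ {r} → p ≤ r → Above (suc n) g (suc p) (suc r) → Above n f p r
  above-new⁻¹ p≤r above i<p r≤j j<n = lower≤ (above (up-<ʳ ≤-refl i<p) (up-≥ʳ p≤r r≤j) (up-<ʳ p≤n j<n))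

  not-above-left : ∀ {q r} → 0 < q → q ≤ p → r ≤ p → ¬ Above (suc n) g q r
  not-above-left 0<q q≤p r≤p above =
    new-max (up-<ʳ p≤n (<-≤-trans 0<q (≤-trans q≤p p≤n)))
            (above (up-<ˡ q≤p 0<q) r≤p (s≤s p≤n))

  -- Being the maximum, the new letter can only play the 4, and the other three letters then form
  -- what `Active` forbids. In any other role it contradicts maximality.
  avoiding-insert : Avoiding n f → Active n f p → Avoiding (suc n) g
  avoiding-insert (avoiding no1432 no2143 no3214) (active no321 no213 no132) = avoiding c1 c2 c3
    where
    c1 : ∀ {i j k l} → i < j → j < k → k < l → l < suc n → g i < g l → g l < g k → g k < g j → ⊥
    c1 {i} {j} {k} {l} i<j j<k k<l l<n gi<gl gl<gk gk<gj
      with position p i | position p j | position p k | position p l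
    ... | new | _ | _ | new = <-irrefl refl gi<gl
    ... | new | _ | _ | old l = new≮ l<n gi<gl
    ... | _ | new | new | _ = <-irrefl refl j<k
    ... | _ | old j | new | _ = new≮ (<-trans j<k (<-trans k<l l<n)) gk<gj
    ... | _ | _ | old k | new = new≮ (<-trans k<l l<n) gl<gk
    ... | old i | new | old k | old l =
      <⇒≱ (lower< gi<gl) (no132 (up-<ˡ⁻¹ ≤-refl i<j) (up-≥ʳ⁻¹ ≤-refl j<k) (up-cancel-< p k<l) (up-<ʳ⁻¹ p≤n l<n) (lower< gl<gk))
    ... | old i | old j | old k | old l =
      no1432 (up-cancel-< p i<j) (up-cancel-< p j<k) (up-cancel-< p k<l) (up-<ʳ⁻¹ p≤n l<n)
             (lower< gi<gl) (lower< gl<gk) (lower< gk<gj)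
    c2 : ∀ {i j k l} → i < j → j < k → k < l → l < suc n → g j < g i → g i < g l → g l < g k → ⊥
    c2 {i} {j} {k} {l} i<j j<k k<l l<n gj<gi gi<gl gl<gk
      with position p i | position p j | position p k | position p l
    ... | new | _ | _ | new = <-irrefl refl gi<gl
    ... | new | _ | _ | old l = new≮ l<n gi<gl
    ... | _ | _ | new | new = <-irrefl refl k<l
    ... | _ | _ | old k | new = new≮ (<-trans k<l l<n) gl<gk
    ... | old i | new | _ | _ = new≮ (<-trans i<j (<-trans j<k (<-trans k<l l<n))) gj<gi
    ... | old i | old j | new | old l =
      <⇒≱ (lower< gi<gl) (no213 (up-cancel-< p i<j) (up-<ˡ⁻¹ ≤-refl j<k) (up-≥ʳ⁻¹ ≤-refl k<l) (up-<ʳ⁻¹ p≤n l<n) (lower< gj<gi))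
    ... | old i | old j | old k | old l =
      no2143 (up-cancel-< p i<j) (up-cancel-< p j<k) (up-cancel-< p k<l) (up-<ʳ⁻¹ p≤n l<n)
             (lower< gj<gi) (lower< gi<gl) (lower< gl<gk)
    c3 : ∀ {i j k l} → i < j → j < k → k < l → l < suc n → g k < g j → g j < g i → g i < g l → ⊥
    c3 {i} {j} {k} {l} i<j j<k k<l l<n gk<gj gj<gi gi<gl
      with position p i | position p j | position p k | position p l
    ... | new | _ | _ | new = <-irrefl refl gi<gl
    ... | new | _ | _ | old l = new≮ l<n gi<gl
    ... | old i | new | _ | _ = new≮ (<-trans i<j (<-trans j<k (<-trans k<l l<n))) gj<gi
    ... | _ | old j | new | _ = new≮ (<-trans j<k (<-trans k<l l<n)) gk<gj
    ... | old i | old j | old k | new =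
      no321 (up-cancel-< p i<j) (up-cancel-< p j<k) (up-<ˡ⁻¹ ≤-refl k<l) (lower< gj<gi) (lower< gk<gj)
    ... | old i | old j | old k | old l =
      no3214 (up-cancel-< p i<j) (up-cancel-< p j<k) (up-cancel-< p k<l) (up-<ʳ⁻¹ p≤n l<n)
             (lower< gk<gj) (lower< gj<gi) (lower< gi<gl)

  avoiding-insert⁻¹ : Avoiding (suc n) g → Avoiding n f × Active n f p
  avoiding-insert⁻¹ (avoiding no1432 no2143 no3214) =
    avoiding
      (λ i<j j<k k<l l<n fi<fl fl<fk fk<fj →
        no1432 (up-mono-< p i<j) (up-mono-< p j<k) (up-mono-< p k<l) (up-<ʳ p≤n l<n)
               (lift< fi<fl) (lift< fl<fk) (lift< fk<fj))
      (λ i<j j<k k<l l<n fj<fi fi<fl fl<fk →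
        no2143 (up-mono-< p i<j) (up-mono-< p j<k) (up-mono-< p k<l) (up-<ʳ p≤n l<n)
               (lift< fj<fi) (lift< fi<fl) (lift< fl<fk))
      (λ i<j j<k k<l l<n fk<fj fj<fi fi<fl →
        no3214 (up-mono-< p i<j) (up-mono-< p j<k) (up-mono-< p k<l) (up-<ʳ p≤n l<n)
               (lift< fk<fj) (lift< fj<fi) (lift< fi<fl)) ,
    active
      (λ i<j j<k k<p fj<fi fk<fj →
        no3214 (up-mono-< p i<j) (up-mono-< p j<k) (up-<ˡ ≤-refl k<p) (s≤s p≤n) (lift< fk<fj) (lift< fj<fi)
               (below-new′ (<-≤-trans (<-trans i<j (<-trans j<k k<p)) p≤n)))
      (λ i<j j<p p≤k k<n fj<fi → ≮⇒≥ λ fi<fk →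
        no2143 (up-mono-< p i<j) (up-<ˡ ≤-refl j<p) (up-≥ʳ ≤-refl p≤k) (up-<ʳ p≤n k<n) (lift< fj<fi)
               (lift< fi<fk) (below-new′ k<n))
      (λ i<p p≤j j<k k<n fk<fj → ≮⇒≥ λ fi<fk →
        no1432 (up-<ˡ ≤-refl i<p) (up-≥ʳ ≤-refl p≤j) (up-mono-< p j<k) (up-<ʳ p≤n k<n)
               (lift< fi<fk) (lift< fk<fj) (below-new′ (<-trans j<k k<n)))

-- The active sites along the generating tree

-- The value `false` asserts the negation instead of nothing: completeness of a child's site list
-- requires knowing that a site dies, not merely failing to know that it survives.
Flag : Bool → Set → Set
Flag true  P = P
Flag false P = ¬ P

Flag-map : ∀ b {P Q : Set} → (P → Q) → (Q → P) → Flag b P → Flag b Q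
Flag-map true  P→Q _   p  = P→Q p
Flag-map false _   Q→P ¬p = ¬p ∘ Q→P

∈-∷ʳ⁺ : {X : Set} {x y : X} {xs : List X} → x ∈ y ∷ xs → x ∈ xs ∷ʳ y
∈-∷ʳ⁺ {xs = xs} (here refl) = ∈-++⁺ʳ xs (here refl)
∈-∷ʳ⁺           (there h)   = ∈-++⁺ˡ h

∈-∷ʳ⁻ : {X : Set} {x y : X} {xs : List X} → x ∈ xs ∷ʳ y → x ∈ y ∷ xs
∈-∷ʳ⁻ {xs = xs} x∈ with ∈-++⁻ xs x∈
... | inj₁ h           = there h
... | inj₂ (here refl) = here refl

tails⁺ : {X : Set} → List X → List (X × List X)
tails⁺ []       = []
tails⁺ (x ∷ xs) = (x , xs) ∷ tails⁺ xs

map-proj₁-tails⁺ : {X : Set} (xs : List X) → map proj₁ (tails⁺ xs) ≡ xs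
map-proj₁-tails⁺ []       = refl
map-proj₁-tails⁺ (x ∷ xs) = cong (x ∷_) (map-proj₁-tails⁺ xs)

tails⁺-∈ : {X : Set} {x : X} {post xs : List X} → (x , post) ∈ tails⁺ xs → x ∈ xs
tails⁺-∈ {xs = _ ∷ _} (here refl) = here refl
tails⁺-∈ {xs = _ ∷ _} (there h)   = there (tails⁺-∈ h)

tails⁺-⊆ : {X : Set} {x y : X} {post xs : List X} → (x , post) ∈ tails⁺ xs → y ∈ post → y ∈ xs
tails⁺-⊆ {xs = _ ∷ _} (here refl) y∈ = there y∈
tails⁺-⊆ {xs = _ ∷ _} (there h)   y∈ = there (tails⁺-⊆ h y∈)

module _ {X : Set} {R : X → X → Set} where

  tails⁺-AllPairs : ∀ {x post xs} → AllPairs R xs → (x , post) ∈ tails⁺ xs → AllPairs R (x ∷ post)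
  tails⁺-AllPairs {xs = _ ∷ _} rs       (here refl) = rs
  tails⁺-AllPairs {xs = _ ∷ _} (_ ∷ rs) (there h)   = tails⁺-AllPairs rs h

  tails⁺-complete : ∀ {x y post xs} → AllPairs R xs → (x , post) ∈ tails⁺ xs → y ∈ xs →
                    y ∈ x ∷ post ⊎ R y x
  tails⁺-complete {xs = _ ∷ _} _        (here refl) y∈          = inj₁ y∈
  tails⁺-complete {xs = _ ∷ _} (r ∷ _)  (there h)   (here refl) = inj₂ (All.lookup r (tails⁺-∈ h))
  tails⁺-complete {xs = _ ∷ _} (_ ∷ rs) (there h)   (there y∈)  = tails⁺-complete rs h y∈

Right : Set
Right = ℕ × Bool × Bool

-- The active sites of a word: 0 and those listed.  In A ms m b rs the prefix in front of a site is
-- increasing exactly for the sites 0, ms and m; the flags of a site q in rs say whether the word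
-- increases between m and q, and whether the letters in front of ms and m exceed those behind q;
-- b is this second flag for q = m.  In Z rs it is increasing for the site 0 only.
data Node : Set where
  Z : List ℕ → Node
  A : List ℕ → ℕ → Bool → List Right → Node

-- Right sites arise behind an inserted maximum and survive there only if the word increases up to
-- them. It therefore increases between any two of them, and an insertion at one keeps all the later
-- ones.
Increasing : {X : Set} → (X → ℕ) → (ℕ → ℕ) → X → X → Set
Increasing site f x y = site x < site y × Inc f (site x) (site y)

record ValidZ (n : ℕ) (f : ℕ → ℕ) (rs : List ℕ) : Set where
  field
    act-zero : Active n f 0
    rights   : ∀ {q} → q ∈ rs → Active n f q × 0 < q × q ≤ n × ¬ Inc f 0 q
    complete : ∀ {q} → q ≤ n → Active n f q → q ∈ 0 ∷ rs
    sorted   : AllPairs (Increasing id f) rs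

-- One second flag serves every `x ∈ m ∷ ms`, so an insertion at q keeps all of these sites or none.
-- The first flag concerns m only, since from 0 and from `ms` the increase up to q always fails.
record RightSite (n : ℕ) (f : ℕ → ℕ) (ms : List ℕ) (m : ℕ) (e : Right) : Set where
  constructor rightSite
  q = proj₁ e
  field
    act   : Active n f q
    m<q   : m < q
    q≤n   : q ≤ n
    inc   : Flag (proj₁ (proj₂ e)) (Inc f m q)
    above : ∀ {x} → x ∈ m ∷ ms → Flag (proj₂ (proj₂ e)) (Above n f x q)
    ¬inc  : ∀ {x} → x ∈ 0 ∷ ms → ¬ Inc f x q

-- The invariant `¬above` holds because the maximum inserted when a site joins `ms` stands behind
-- all members of `ms`, whose prefixes are non-empty. It makes an insertion at a middle site kill
-- every middle site up to and including that one.
record ValidA (n : ℕ) (f : ℕ → ℕ) (ms : List ℕ) (m : ℕ) (b : Bool) (rs : List Right) : Set where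
  field
    act-zero : Active n f 0
    middle   : ∀ {x} → x ∈ ms → Active n f x × 0 < x × x < m
    act-m    : Active n f m
    0<m      : 0 < m
    m≤n      : m ≤ n
    rights   : ∀ {e} → e ∈ rs → RightSite n f ms m e
    complete : ∀ {q} → q ≤ n → Active n f q → q ∈ 0 ∷ m ∷ ms ⊎ q ∈ map proj₁ rs
    inc      : Inc f 0 m
    above    : ∀ {x} → x ∈ m ∷ ms → Flag b (Above n f x m)
    ¬above   : ∀ {x y} → x ∈ ms → y ∈ ms → ¬ Above n f x y
    sortedᵐ  : AllPairs _<_ ms
    sortedʳ  : AllPairs (Increasing proj₁ f) rs

Valid : ℕ → (ℕ → ℕ) → Node → Set
Valid n f (Z rs)        = ValidZ n f rs
Valid n f (A ms m b rs) = ValidA n f ms m b rs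

keep : List Right → List Right
keep []                   = []
keep ((q , true  , g) ∷ rs) = (suc q , true , g) ∷ keep rs
keep ((q , false , g) ∷ rs) = keep rs

flagged : Bool → Bool → ℕ → Right
flagged t g q = suc q , t , g

-- Right sites in front of q die because their prefixes do not increase; those behind q live because
-- the word increases from q to them.
zKid : ℕ × List ℕ → ℕ × Node
zKid (q , post) = q , Z (suc q ∷ map suc post)

-- The middle sites behind x, and m, end up to the right of the new letter and become right sites;
-- those up to x die by `¬above`. The old right sites die because the word does not increase from x
-- to them.
middleKid : ℕ → Bool → ℕ × List ℕ → ℕ × Node
middleKid m b (x , post) = x , A [] (suc x) false (map (flagged true false) post ∷ʳ flagged true b m)

-- If the flag is `true`, the gap m survives on both sides of the new letter and its left half joins
-- `ms`; no other insertion enlarges `ms`. Otherwise 0 is the only survivor in front of the new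
-- letter.
mKid : List ℕ → ℕ → Bool → List Right → ℕ × Node
mKid ms m true  rs = m , A (ms ∷ʳ m) (suc m) true (keep rs)
mKid ms m false rs = m , A [] (suc m) false (keep rs)

-- If the second flag holds, 0, `ms` and m all survive, while the new letter breaks the increase
-- from m to the sites behind it and falsifies the flag of m. Otherwise only 0 survives in front of
-- the new letter, and no positive site with an increasing prefix is left.
rightKid : List ℕ → ℕ → Right × List Right → ℕ × Node
rightKid ms m ((q , t , true)  , post) = q , A ms m false ((suc q , t , true) ∷ map (flagged false true ∘ proj₁) post)
rightKid ms m ((q , t , false) , post) = q , Z (suc q ∷ map (suc ∘ proj₁) post)

kids : Node → List (ℕ × Node)
kids (Z rs)        = (0 , A [] 1 true []) ∷ map zKid (tails⁺ rs)
kids (A ms m b rs) =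
  (0 , A [] 1 true (map (flagged true true) (ms ∷ʳ m))) ∷
  map (middleKid m b) (tails⁺ ms) ++ mKid ms m b rs ∷ map (rightKid ms m) (tails⁺ rs)

Inc-sub : ∀ {f p p′ q q′} → p ≤ p′ → q′ ≤ q → Inc f p q → Inc f p′ q′
Inc-sub p≤p′ q′≤q inc p′≤i i<j j<q′ = inc (≤-trans p≤p′ p′≤i) i<j (<-≤-trans j<q′ q′≤q)

Inc-empty : ∀ {f p q} → q ≤ suc p → Inc f p q
Inc-empty q≤p p≤i i<j j<q = ⊥-elim (<⇒≱ (<-≤-trans j<q q≤p) (≤-trans (s≤s p≤i) i<j))

Above-zero : ∀ {n f p} → Above n f 0 p
Above-zero ()

Above-mono : ∀ {n f p q r} → q ≤ r → Above n f p q → Above n f p r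
Above-mono q≤r above i<p r≤j j<n = above i<p (≤-trans q≤r r≤j) j<n

∈-keep⁺ : ∀ {q g rs} → (q , true , g) ∈ rs → (suc q , true , g) ∈ keep rs
∈-keep⁺ (here refl) = here refl
∈-keep⁺ {rs = (_ , true  , _) ∷ _} (there h) = there (∈-keep⁺ h)
∈-keep⁺ {rs = (_ , false , _) ∷ _} (there h) = ∈-keep⁺ h

∈-keep⁻ : ∀ {e} rs → e ∈ keep rs → ∃ λ q → ∃ λ g → e ≡ (suc q , true , g) × (q , true , g) ∈ rs
∈-keep⁻ ((_ , true  , _) ∷ _)  (here refl) = _ , _ , refl , here refl
∈-keep⁻ ((_ , true  , _) ∷ rs) (there h)   = let q , g , eq , h′ = ∈-keep⁻ rs h in q , g , eq , there h′
∈-keep⁻ ((_ , false , _) ∷ rs) h           = let q , g , eq , h′ = ∈-keep⁻ rs h in q , g , eq , there h′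

-- Validity of the children of a valid node

module Children {n p : ℕ} {f g : ℕ → ℕ} (p≤n : p ≤ n)
                (f<n : ∀ {i} → i < n → f i < n)
                (g-new : g p ≡ n) (g-old : ∀ i → g (up p i) ≡ f i) where

  open Insertion {n} {p} {f} {g} p≤n f<n g-new g-old

  data ActiveCases : ℕ → Set where
    left  : ∀ {q} → q ≤ p → Active n f q → Inc f 0 q → Above n f q p → ActiveCases q
    new   : ActiveCases (suc p)
    right : ∀ {q} → p < q → q ≤ n → Active n f q → Inc f p q → ActiveCases (suc q)

  activeCases : ∀ {q} → q ≤ suc n → Active (suc n) g q → ActiveCases q
  activeCases {q} q≤n act with q ≤? p
  activeCases {q} q≤n act | yes q≤p =
    let act′ , inc , above = active-left⁻¹ q≤p act in left q≤p act′ inc above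
  activeCases {zero} q≤n act | no q≰p = ⊥-elim (q≰p z≤n)
  activeCases {suc q} (s≤s q≤n) act | no q≰p with m≤n⇒m<n∨m≡n (≤-pred (≰⇒> q≰p))
  ... | inj₂ refl = new
  ... | inj₁ p<q  = let act′ , inc = active-right⁻¹ (<⇒≤ p<q) q≤n act in right p<q q≤n act′ inc

  active-zero : Active n f 0 → Active (suc n) g 0
  active-zero act = active-left z≤n act (Inc-empty z≤n) Above-zero

  increasing-suc : ∀ {q r} → p ≤ q → q < r × Inc f q r → suc q < suc r × Inc g (suc q) (suc r)
  increasing-suc p≤q (q<r , inc) = s<s q<r , inc-right p≤q inc

  increasing-map : ∀ {X Y : Set} {site : X → ℕ} {site′ : Y → ℕ} (h : X → Y) →
                   (∀ x → site′ (h x) ≡ suc (site x)) → ∀ {xs} →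
                   All (λ x → p ≤ site x) xs → AllPairs (Increasing site f) xs →
                   AllPairs (Increasing site′ g) (map h xs)
  increasing-map h eq [] [] = []
  increasing-map {site = site} {site′} h eq {x ∷ _} (p≤x ∷ p≤xs) (r ∷ rs) =
    All.map⁺ (All.map step r) ∷ increasing-map h eq p≤xs rs
    where
    step : ∀ {y} → Increasing site f x y → Increasing site′ g (h x) (h y)
    step {y} inc = subst₂ (λ a b → a < b × Inc g a b) (sym (eq x)) (sym (eq y)) (increasing-suc p≤x inc)

  module _ {rs : List ℕ} (v : ValidZ n f rs) where
    open ValidZ v

    -- Behind a new first letter only sites with a formerly increasing prefix survive, and no right
    -- site of a Z node has one.
    zero-child-Z : p ≡ 0 → ValidA (suc n) g [] 1 true []
    zero-child-Z refl = record
      { act-zero = active-zero act-zero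
      ; middle = λ ()
      ; act-m = active-new act-zero
      ; 0<m = z<s
      ; m≤n = s≤s z≤n
      ; rights = λ ()
      ; complete = λ q≤n act → inj₁ (compl q≤n act)
      ; inc = Inc-empty ≤-refl
      ; above = λ { (here refl) → above-new z≤n Above-zero }
      ; ¬above = λ ()
      ; sortedᵐ = []
      ; sortedʳ = []
      }
      where
      compl : ∀ {q} → q ≤ suc n → Active (suc n) g q → q ∈ 0 ∷ 1 ∷ []
      compl q≤n act with activeCases q≤n act
      ... | left z≤n _ _ _ = here refl
      ... | new = there (here refl)
      ... | right 0<q q≤n act inc with complete q≤n act
      ... | here refl = ⊥-elim (<-irrefl refl 0<q)
      ... | there q∈ = ⊥-elim (proj₂ (proj₂ (proj₂ (rights q∈))) inc)

    right-child-Z : ∀ {post} → (p , post) ∈ tails⁺ rs → ValidZ (suc n) g (suc p ∷ map suc post)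
    right-child-Z {post} p∈ = record
      { act-zero = active-zero act-zero
      ; rights = rt
      ; complete = compl
      ; sorted = increasing-map suc (λ _ → refl) (≤-refl ∷ All.map (<⇒≤ ∘ proj₁) (AllPairs.head srt)) srt
      }
      where
      srt : AllPairs (Increasing id f) (p ∷ post)
      srt = tails⁺-AllPairs sorted p∈
      rt : ∀ {q} → q ∈ suc p ∷ map suc post → Active (suc n) g q × 0 < q × q ≤ suc n × ¬ Inc g 0 q
      rt (here refl) =
        let act , 0<p , p≤n , ¬inc = rights (tails⁺-∈ p∈)
        in active-new act , z<s , s≤s p≤n , λ i → ¬inc (inc-new⁻¹ z≤n i)
      rt (there h) with ∈-map⁻ suc h
      ... | q , q∈ , refl =
        let act , 0<q , q≤n , ¬inc = rights (tails⁺-⊆ p∈ q∈)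
            p<q , inc = All.lookup (AllPairs.head srt) q∈
        in active-right p<q q≤n act inc , z<s , s≤s q≤n , not-inc-across z≤n p<q q≤n
      compl : ∀ {q} → q ≤ suc n → Active (suc n) g q → q ∈ 0 ∷ suc p ∷ map suc post
      compl q≤n act with activeCases q≤n act
      compl q≤n act | left {q} q≤p act′ inc _ with complete (≤-trans q≤p p≤n) act′
      ... | here refl = here refl
      ... | there q∈ = ⊥-elim (proj₂ (proj₂ (proj₂ (rights q∈))) inc)
      compl q≤n act | new = there (here refl)
      compl q≤n act | right {q} p<q q≤n′ act′ inc with complete q≤n′ act′
      ... | here refl = ⊥-elim (<⇒≱ p<q z≤n)
      ... | there q∈ with tails⁺-complete sorted p∈ q∈
      ... | inj₁ (here refl) = ⊥-elim (<-irrefl refl p<q)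
      ... | inj₁ (there q∈′) = there (there (∈-map⁺ suc q∈′))
      ... | inj₂ (q<p , _) = ⊥-elim (<-asym p<q q<p)

  increasing-keep : ∀ {rs} → All (λ e → p ≤ proj₁ e) rs → AllPairs (Increasing proj₁ f) rs →
                    AllPairs (Increasing proj₁ g) (keep rs)
  increasing-keep [] [] = []
  increasing-keep {(_ , false , _) ∷ _} (_ ∷ p≤) (_ ∷ rs) = increasing-keep p≤ rs
  increasing-keep {(q , true , _) ∷ rest} (p≤q ∷ p≤) (r ∷ rs) = All.tabulate step ∷ increasing-keep p≤ rs
    where
    step : ∀ {e} → e ∈ keep rest → suc q < proj₁ e × Inc g (suc q) (proj₁ e)
    step e∈ with ∈-keep⁻ rest e∈
    ... | _ , _ , refl , h = increasing-suc p≤q (All.lookup r h)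

  module _ {ms : List ℕ} {m : ℕ} {b : Bool} {rs : List Right} (v : ValidA n f ms m b rs) where
    open ValidA v

    middle≤m : ∀ {x} → x ∈ m ∷ ms → x ≤ m
    middle≤m (here refl) = ≤-refl
    middle≤m (there x∈)  = <⇒≤ (proj₂ (proj₂ (middle x∈)))

    middle>0 : ∀ {x} → x ∈ m ∷ ms → 0 < x
    middle>0 (here refl) = 0<m
    middle>0 (there x∈)  = proj₁ (proj₂ (middle x∈))

    active-middle : ∀ {x} → x ∈ m ∷ ms → Active n f x
    active-middle (here refl) = act-m
    active-middle (there x∈)  = proj₁ (middle x∈)

    increasing-middle : ∀ {xs} → (∀ {x} → x ∈ xs → x ∈ ms) → AllPairs _<_ xs → AllPairs (Increasing id f) xs
    increasing-middle ⊆ [] = []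
    increasing-middle ⊆ (r ∷ rs) =
      All.tabulate (λ y∈ → All.lookup r y∈ , Inc-sub z≤n (<⇒≤ (proj₂ (proj₂ (middle (⊆ (there y∈)))))) inc) ∷
      increasing-middle (⊆ ∘ there) rs

    rightSites : ∀ {q} → q ∈ map proj₁ rs → ∃ λ t → ∃ λ g → (q , t , g) ∈ rs
    rightSites q∈ with ∈-map⁻ proj₁ q∈
    ... | (_ , t , g) , e∈ , refl = t , g , e∈

    -- The sites with increasing prefix turn into right sites behind the new first letter. Their
    -- second flag is true because the prefix of the site 1 is just this maximum.
    zero-child : p ≡ 0 → ValidA (suc n) g [] 1 true (map (flagged true true) (ms ∷ʳ m))
    zero-child refl = record
      { act-zero = active-zero act-zero
      ; middle = λ ()
      ; act-m = active-new act-zero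
      ; 0<m = z<s
      ; m≤n = s≤s z≤n
      ; rights = rts
      ; complete = compl
      ; inc = Inc-empty ≤-refl
      ; above = λ { (here refl) → above-new z≤n Above-zero }
      ; ¬above = λ ()
      ; sortedᵐ = []
      ; sortedʳ = increasing-map (flagged true true) (λ _ → refl) (All.tabulate λ _ → z≤n) sorted
      }
      where
      sorted : AllPairs (Increasing id f) (ms ∷ʳ m)
      sorted = AllPairs.++⁺
        (increasing-middle id sortedᵐ) ([] ∷ []) (All.tabulate λ x∈ → (proj₂ (proj₂ (middle x∈)) , Inc-sub z≤n ≤-refl inc) ∷ [])
      rts : ∀ {e} → e ∈ map (flagged true true) (ms ∷ʳ m) → RightSite (suc n) g [] 1 e
      rts e∈ with ∈-map⁻ (flagged true true) e∈
      ... | x , x∈ , refl = rightSite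
        (active-right (middle>0 x∈′) (≤-trans (middle≤m x∈′) m≤n) (active-middle x∈′) (Inc-sub z≤n (middle≤m x∈′) inc))
        (s<s (middle>0 x∈′)) (s≤s (≤-trans (middle≤m x∈′) m≤n))
        (inc-right z≤n (Inc-sub z≤n (middle≤m x∈′) inc))
        (λ { (here refl) → above-new z≤n Above-zero })
        (λ { (here refl) → not-inc-across z≤n (middle>0 x∈′) (≤-trans (middle≤m x∈′) m≤n) })
        where x∈′ = ∈-∷ʳ⁻ x∈
      compl : ∀ {q} → q ≤ suc n → Active (suc n) g q →
              q ∈ 0 ∷ 1 ∷ [] ⊎ q ∈ map proj₁ (map (flagged true true) (ms ∷ʳ m))
      compl q≤n act with activeCases q≤n act
      ... | left z≤n _ _ _ = inj₁ (here refl)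
      ... | new = inj₁ (there (here refl))
      ... | right 0<q q≤n act inc with complete q≤n act
      ... | inj₁ (here refl) = ⊥-elim (<-irrefl refl 0<q)
      ... | inj₁ (there q∈) = inj₂ (∈-map⁺ proj₁ (∈-map⁺ (flagged true true) (∈-∷ʳ⁺ q∈)))
      ... | inj₂ q∈ with rightSites q∈
      ... | _ , _ , e∈ = ⊥-elim (RightSite.¬inc (rights e∈) (here refl) inc)

    middle-child : ∀ {post} → (p , post) ∈ tails⁺ ms →
                   ValidA (suc n) g [] (suc p) false (map (flagged true false) post ∷ʳ flagged true b m)
    middle-child {post} p∈ = record
      { act-zero = active-zero act-zero
      ; middle = λ ()
      ; act-m = active-new act-p
      ; 0<m = z<s
      ; m≤n = s≤s p≤n
      ; rights = rts
      ; complete = compl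
      ; inc = inc-new z≤n (Inc-sub z≤n (<⇒≤ p<m) inc)
      ; above = λ { (here refl) above → ¬above p∈ms p∈ms (above-new⁻¹ ≤-refl above) }
      ; ¬above = λ ()
      ; sortedᵐ = []
      ; sortedʳ = AllPairs.++⁺
          (increasing-map (flagged true false) (λ _ → refl) (All.map <⇒≤ p<post) (increasing-middle post⊆ sorted-post))
          ([] ∷ [])
          (All.map⁺ (All.tabulate λ y∈ →
            increasing-suc (<⇒≤ (All.lookup p<post y∈)) (y<m y∈ , Inc-sub z≤n ≤-refl inc) ∷ []))
      }
      where
      p∈ms : p ∈ ms
      p∈ms = tails⁺-∈ p∈
      act-p = proj₁ (middle p∈ms)
      p<m = proj₂ (proj₂ (middle p∈ms))
      post⊆ : ∀ {y} → y ∈ post → y ∈ ms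
      post⊆ = tails⁺-⊆ p∈
      p<post : All (p <_) post
      p<post = AllPairs.head (tails⁺-AllPairs sortedᵐ p∈)
      sorted-post : AllPairs _<_ post
      sorted-post = AllPairs.tail (tails⁺-AllPairs sortedᵐ p∈)
      y<m : ∀ {y} → y ∈ post → y < m
      y<m y∈ = proj₂ (proj₂ (middle (post⊆ y∈)))
      rts : ∀ {e} → e ∈ map (flagged true false) post ∷ʳ flagged true b m → RightSite (suc n) g [] (suc p) e
      rts e∈ with ∈-++⁻ (map (flagged true false) post) e∈
      ... | inj₂ (here refl) = rightSite
        (active-right p<m m≤n act-m (Inc-sub z≤n ≤-refl inc))
        (s<s p<m) (s≤s m≤n)
        (inc-right ≤-refl (Inc-sub z≤n ≤-refl inc))
        -- Here it matters that `b` is uniform over `m ∷ ms`: the flag of m is read at the middle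
        -- site p, not at m.
        (λ { (here refl) → Flag-map b (above-new (<⇒≤ p<m)) (above-new⁻¹ (<⇒≤ p<m)) (above (there p∈ms)) })
        (λ { (here refl) → not-inc-across z≤n p<m m≤n })
      ... | inj₁ h with ∈-map⁻ (flagged true false) h
      ... | y , y∈ , refl = rightSite
        (active-right p<y y≤n (proj₁ (middle (post⊆ y∈))) (Inc-sub z≤n (<⇒≤ (y<m y∈)) inc))
        (s<s p<y) (s≤s y≤n)
        (inc-right ≤-refl (Inc-sub z≤n (<⇒≤ (y<m y∈)) inc))
        (λ { (here refl) above → ¬above p∈ms (post⊆ y∈) (above-new⁻¹ (<⇒≤ p<y) above) })
        (λ { (here refl) → not-inc-across z≤n p<y y≤n })
        where
        p<y = All.lookup p<post y∈
        y≤n = ≤-trans (<⇒≤ (y<m y∈)) m≤n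
      compl : ∀ {q} → q ≤ suc n → Active (suc n) g q →
              q ∈ 0 ∷ suc p ∷ [] ⊎ q ∈ map proj₁ (map (flagged true false) post ∷ʳ flagged true b m)
      compl q≤n act with activeCases q≤n act
      compl q≤n act | left {q} q≤p act′ inc′ above′ with complete (≤-trans q≤p p≤n) act′
      ... | inj₁ (here refl) = inj₁ (here refl)
      ... | inj₁ (there (here refl)) = ⊥-elim (<⇒≱ p<m q≤p)
      ... | inj₁ (there (there q∈)) = ⊥-elim (¬above q∈ p∈ms above′)
      ... | inj₂ q∈ with rightSites q∈
      ... | _ , _ , e∈ = ⊥-elim (RightSite.¬inc (rights e∈) (here refl) inc′)
      compl q≤n act | new = inj₁ (there (here refl))
      compl q≤n act | right {q} p<q q≤n′ act′ inc′ with complete q≤n′ act′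
      ... | inj₁ (here refl) = ⊥-elim (<⇒≱ p<q z≤n)
      ... | inj₁ (there (here refl)) =
        inj₂ (∈-map⁺ proj₁ (∈-++⁺ʳ (map (flagged true false) post) (here {x = flagged true b m} refl)))
      ... | inj₂ q∈ with rightSites q∈
      ... | _ , _ , e∈ = ⊥-elim (RightSite.¬inc (rights e∈) (there p∈ms) inc′)
      compl q≤n act | right {q} p<q q≤n′ act′ inc′ | inj₁ (there (there q∈))
        with tails⁺-complete sortedᵐ p∈ q∈
      ... | inj₁ (here refl) = ⊥-elim (<-irrefl refl p<q)
      ... | inj₁ (there q∈′) = inj₂ (∈-map⁺ proj₁ (∈-++⁺ˡ {ys = flagged true b m ∷ []} (∈-map⁺ (flagged true false) q∈′)))
      ... | inj₂ q<p = ⊥-elim (<-asym p<q q<p)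

    keep-≥m : All (λ e → m ≤ proj₁ e) rs
    keep-≥m = All.tabulate λ e∈ → <⇒≤ (RightSite.m<q (rights e∈))

    keep-complete : p ≡ m → ∀ {q} → p < q → q ∈ map proj₁ rs → Inc f p q → suc q ∈ map proj₁ (keep rs)
    keep-complete refl p<q q∈ inc′ with rightSites q∈
    ... | true  , _ , e∈ = ∈-map⁺ proj₁ (∈-keep⁺ e∈)
    ... | false , _ , e∈ = ⊥-elim (RightSite.inc (rights e∈) inc′)

    m-child-true : p ≡ m → b ≡ true → ValidA (suc n) g (ms ∷ʳ m) (suc m) true (keep rs)
    m-child-true refl refl = record
      { act-zero = active-zero act-zero
      ; middle = λ x∈ → let x∈′ = ∈-∷ʳ⁻ x∈ in
          active-left (middle≤m x∈′) (active-middle x∈′) (Inc-sub ≤-refl (middle≤m x∈′) inc) (above x∈′) ,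
          middle>0 x∈′ , s≤s (middle≤m x∈′)
      ; act-m = active-new act-m
      ; 0<m = z<s
      ; m≤n = s≤s m≤n
      ; rights = rts
      ; complete = compl
      ; inc = inc-new z≤n inc
      ; above = abv
      ; ¬above = λ x∈ y∈ → not-above-left (middle>0 (∈-∷ʳ⁻ x∈)) (middle≤m (∈-∷ʳ⁻ x∈)) (middle≤m (∈-∷ʳ⁻ y∈))
      ; sortedᵐ = AllPairs.++⁺ sortedᵐ ([] ∷ []) (All.tabulate λ x∈ → proj₂ (proj₂ (middle x∈)) ∷ [])
      ; sortedʳ = increasing-keep keep-≥m sortedʳ
      }
      where
      abv : ∀ {x} → x ∈ suc m ∷ ms ∷ʳ m → Above (suc n) g x (suc m)
      abv (here refl) = above-new ≤-refl (above (here refl))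
      abv (there x∈)  = above-left (middle≤m (∈-∷ʳ⁻ x∈)) ≤-refl (above (∈-∷ʳ⁻ x∈))
      rts : ∀ {e} → e ∈ keep rs → RightSite (suc n) g (ms ∷ʳ m) (suc m) e
      rts e∈ with ∈-keep⁻ rs e∈
      ... | q , t , refl , h = rightSite
        (active-right m<q q≤n act inc-q) (s<s m<q) (s≤s q≤n) (inc-right ≤-refl inc-q)
        (λ { (here refl) → Flag-map t (above-new (<⇒≤ m<q)) (above-new⁻¹ (<⇒≤ m<q)) (above-q (here refl))
           ; (there x∈) → let x≤m = middle≤m (∈-∷ʳ⁻ x∈) in
               Flag-map t (above-left x≤m (<⇒≤ m<q)) (above-left⁻¹ x≤m (<⇒≤ m<q)) (above-q (∈-∷ʳ⁻ x∈)) })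
        (λ { (here refl) → not-inc-across z≤n m<q q≤n
           ; (there x∈) → not-inc-across (middle≤m (∈-∷ʳ⁻ x∈)) m<q q≤n })
        where open RightSite (rights h) using (act; m<q; q≤n; ¬inc) renaming (inc to inc-q; above to above-q)
      compl : ∀ {q} → q ≤ suc n → Active (suc n) g q → q ∈ 0 ∷ suc m ∷ (ms ∷ʳ m) ⊎ q ∈ map proj₁ (keep rs)
      compl q≤n act with activeCases q≤n act
      compl q≤n act | new = inj₁ (there (here refl))
      compl q≤n act | left {q} q≤p act′ inc′ above′ with complete (≤-trans q≤p p≤n) act′
      ... | inj₁ (here refl) = inj₁ (here refl)
      ... | inj₁ (there q∈) = inj₁ (there (there (∈-∷ʳ⁺ q∈)))
      ... | inj₂ q∈ with rightSites q∈
      ... | _ , _ , e∈ = ⊥-elim (<⇒≱ (RightSite.m<q (rights e∈)) q≤p)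
      compl q≤n act | right {q} p<q q≤n′ act′ inc′ with complete q≤n′ act′
      ... | inj₁ (here refl) = ⊥-elim (<⇒≱ p<q z≤n)
      ... | inj₁ (there q∈) = ⊥-elim (<⇒≱ p<q (middle≤m q∈))
      ... | inj₂ q∈ = inj₂ (keep-complete refl p<q q∈ inc′)

    m-child-false : p ≡ m → b ≡ false → ValidA (suc n) g [] (suc m) false (keep rs)
    m-child-false refl refl = record
      { act-zero = active-zero act-zero
      ; middle = λ ()
      ; act-m = active-new act-m
      ; 0<m = z<s
      ; m≤n = s≤s m≤n
      ; rights = rts
      ; complete = compl
      ; inc = inc-new z≤n inc
      ; above = λ { (here refl) abv → above (here refl) (above-new⁻¹ ≤-refl abv) }
      ; ¬above = λ ()
      ; sortedᵐ = []
      ; sortedʳ = increasing-keep keep-≥m sortedʳ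
      }
      where
      rts : ∀ {e} → e ∈ keep rs → RightSite (suc n) g [] (suc m) e
      rts e∈ with ∈-keep⁻ rs e∈
      ... | q , t , refl , h = rightSite
        (active-right m<q q≤n act inc-q) (s<s m<q) (s≤s q≤n) (inc-right ≤-refl inc-q)
        (λ { (here refl) → Flag-map t (above-new (<⇒≤ m<q)) (above-new⁻¹ (<⇒≤ m<q)) (above-q (here refl)) })
        (λ { (here refl) → not-inc-across z≤n m<q q≤n })
        where open RightSite (rights h) using (act; m<q; q≤n; ¬inc) renaming (inc to inc-q; above to above-q)
      compl : ∀ {q} → q ≤ suc n → Active (suc n) g q → q ∈ 0 ∷ suc m ∷ [] ⊎ q ∈ map proj₁ (keep rs)
      compl q≤n act with activeCases q≤n act
      compl q≤n act | new = inj₁ (there (here refl))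
      compl q≤n act | left {q} q≤p act′ inc′ above′ with complete (≤-trans q≤p p≤n) act′
      ... | inj₁ (here refl) = inj₁ (here refl)
      ... | inj₁ (there q∈) = ⊥-elim (above q∈ above′)
      ... | inj₂ q∈ with rightSites q∈
      ... | _ , _ , e∈ = ⊥-elim (<⇒≱ (RightSite.m<q (rights e∈)) q≤p)
      compl q≤n act | right {q} p<q q≤n′ act′ inc′ with complete q≤n′ act′
      ... | inj₁ (here refl) = ⊥-elim (<⇒≱ p<q z≤n)
      ... | inj₁ (there q∈) = ⊥-elim (<⇒≱ p<q (middle≤m q∈))
      ... | inj₂ q∈ = inj₂ (keep-complete refl p<q q∈ inc′)

    module _ {t u : Bool} {post : List Right} (e∈ : ((p , t , u) , post) ∈ tails⁺ rs) where

      private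
        site : RightSite n f ms m (p , t , u)
        site = rights (tails⁺-∈ e∈)
        open RightSite site using (m<q) renaming (act to act-p; inc to inc-p; above to above-p; ¬inc to ¬inc-p)

        sorted-post : AllPairs (Increasing proj₁ f) ((p , t , u) ∷ post)
        sorted-post = tails⁺-AllPairs sortedʳ e∈

        post-increasing : ∀ {e} → e ∈ post → p < proj₁ e × Inc f p (proj₁ e)
        post-increasing = All.lookup (AllPairs.head sorted-post)

        post-≤n : ∀ {e} → e ∈ post → proj₁ e ≤ n
        post-≤n e∈′ = RightSite.q≤n (rights (tails⁺-⊆ e∈ e∈′))

        post-active : ∀ {e} → e ∈ post → Active (suc n) g (suc (proj₁ e))
        post-active e∈′ =
          let p<q , inc = post-increasing e∈′
          in active-right p<q (post-≤n e∈′) (RightSite.act (rights (tails⁺-⊆ e∈ e∈′))) inc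

        post-complete : ∀ {q} → p < q → q ≤ n → Active n f q → q ∈ map proj₁ post
        post-complete p<q q≤n act with complete q≤n act
        ... | inj₁ (here refl) = ⊥-elim (<⇒≱ p<q z≤n)
        ... | inj₁ (there q∈) = ⊥-elim (<⇒≱ (<-trans m<q p<q) (middle≤m q∈))
        ... | inj₂ q∈ with ∈-map⁻ proj₁ q∈
        ... | e , h , refl with tails⁺-complete sortedʳ e∈ h
        ... | inj₁ (here refl) = ⊥-elim (<-irrefl refl p<q)
        ... | inj₁ (there h′) = ∈-map⁺ proj₁ h′
        ... | inj₂ (q<p , _) = ⊥-elim (<-asym p<q q<p)

      right-child-true : u ≡ true → ValidA (suc n) g ms m false ((suc p , t , true) ∷ map (flagged false true ∘ proj₁) post)
      right-child-true refl = record
        { act-zero = active-zero act-zero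
        ; middle = λ x∈ →
            let act , 0<x , x<m = middle x∈
            in active-left (<⇒≤ (<-trans x<m m<q)) act (Inc-sub ≤-refl (<⇒≤ x<m) inc) (above-p (there x∈)) , 0<x , x<m
        ; act-m = active-left (<⇒≤ m<q) act-m inc (above-p (here refl))
        ; 0<m = 0<m
        ; m≤n = ≤-trans m≤n (n≤1+n n)
        ; rights = rts
        ; complete = compl
        ; inc = inc-left (<⇒≤ m<q) inc
        ; above = λ x∈ → not-above-left (middle>0 x∈) (≤p x∈) (<⇒≤ m<q)
        ; ¬above = λ x∈ y∈ → not-above-left (middle>0 (there x∈)) (≤p (there x∈)) (≤p (there y∈))
        ; sortedᵐ = sortedᵐ
        ; sortedʳ = All.map⁺ (All.map (increasing-suc ≤-refl) (AllPairs.head sorted-post)) ∷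
            increasing-map (flagged false true ∘ proj₁) (λ _ → refl)
              (All.map (<⇒≤ ∘ proj₁) (AllPairs.head sorted-post)) (AllPairs.tail sorted-post)
        }
        where
        ≤p : ∀ {x} → x ∈ m ∷ ms → x ≤ p
        ≤p x∈ = ≤-trans (middle≤m x∈) (<⇒≤ m<q)
        zero≤p : ∀ {x} → x ∈ 0 ∷ ms → x ≤ p
        zero≤p (here refl) = z≤n
        zero≤p (there x∈)  = ≤p (there x∈)
        rts : ∀ {e} → e ∈ (suc p , t , true) ∷ map (flagged false true ∘ proj₁) post → RightSite (suc n) g ms m e
        rts (here refl) = rightSite (active-new act-p) (m≤n⇒m≤1+n m<q) (s≤s p≤n)
          -- A maximum at the end of the stretch from m does not affect whether the stretch
          -- increases, so the flag t is inherited.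
          (Flag-map t (inc-new (<⇒≤ m<q)) (inc-new⁻¹ (<⇒≤ m<q)) inc-p)
          (λ x∈ → above-left (≤p x∈) ≤-refl (above-p x∈))
          (λ x∈ inc′ → ¬inc-p x∈ (inc-new⁻¹ (zero≤p x∈) inc′))
        rts (there h) with ∈-map⁻ (flagged false true ∘ proj₁) h
        ... | e , e∈′ , refl = rightSite (post-active e∈′) (m≤n⇒m≤1+n (<-trans m<q p<q)) (s≤s (post-≤n e∈′))
          (not-inc-across (<⇒≤ m<q) p<q (post-≤n e∈′))
          (λ x∈ → above-left (≤p x∈) (<⇒≤ p<q) (Above-mono (<⇒≤ p<q) (above-p x∈)))
          (λ x∈ → not-inc-across (zero≤p x∈) p<q (post-≤n e∈′))
          where p<q = proj₁ (post-increasing e∈′)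
        compl : ∀ {q} → q ≤ suc n → Active (suc n) g q →
                q ∈ 0 ∷ m ∷ ms ⊎ q ∈ suc p ∷ map proj₁ (map (flagged false true ∘ proj₁) post)
        compl q≤n act with activeCases q≤n act
        compl q≤n act | new = inj₂ (here refl)
        compl q≤n act | left {q} q≤p act′ inc′ above′ with complete (≤-trans q≤p p≤n) act′
        ... | inj₁ q∈ = inj₁ q∈
        ... | inj₂ q∈ with rightSites q∈
        ... | _ , _ , h = ⊥-elim (RightSite.¬inc (rights h) (here refl) inc′)
        compl q≤n act | right {q} p<q q≤n′ act′ inc′ with ∈-map⁻ proj₁ (post-complete p<q q≤n′ act′)
        ... | e , h , refl = inj₂ (there (∈-map⁺ proj₁ (∈-map⁺ (flagged false true ∘ proj₁) h)))

      right-child-false : u ≡ false → ValidZ (suc n) g (suc p ∷ map (suc ∘ proj₁) post)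
      right-child-false refl = record
        { act-zero = active-zero act-zero
        ; rights = rts
        ; complete = compl
        ; sorted = increasing-map (suc ∘ proj₁) (λ _ → refl)
            (≤-refl ∷ All.map (<⇒≤ ∘ proj₁) (AllPairs.head sorted-post)) sorted-post
        }
        where
        rts : ∀ {q} → q ∈ suc p ∷ map (suc ∘ proj₁) post → Active (suc n) g q × 0 < q × q ≤ suc n × ¬ Inc g 0 q
        rts (here refl) = active-new act-p , z<s , s≤s p≤n , λ inc′ → ¬inc-p (here refl) (inc-new⁻¹ z≤n inc′)
        rts (there h) with ∈-map⁻ (suc ∘ proj₁) h
        ... | e , e∈′ , refl =
          post-active e∈′ , z<s , s≤s (post-≤n e∈′) , not-inc-across z≤n (proj₁ (post-increasing e∈′)) (post-≤n e∈′)
        compl : ∀ {q} → q ≤ suc n → Active (suc n) g q → q ∈ 0 ∷ suc p ∷ map (suc ∘ proj₁) post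
        compl q≤n act with activeCases q≤n act
        compl q≤n act | new = there (here refl)
        compl q≤n act | left {q} q≤p act′ inc′ above′ with complete (≤-trans q≤p p≤n) act′
        ... | inj₁ (here refl) = here refl
        ... | inj₁ (there q∈) = ⊥-elim (above-p q∈ above′)
        ... | inj₂ q∈ with rightSites q∈
        ... | _ , _ , h = ⊥-elim (RightSite.¬inc (rights h) (here refl) inc′)
        compl q≤n act | right {q} p<q q≤n′ act′ inc′ with ∈-map⁻ proj₁ (post-complete p<q q≤n′ act′)
        ... | e , h , refl = there (there (∈-map⁺ (suc ∘ proj₁) h))

  child-valid : ∀ r {r′} → Valid n f r → (p , r′) ∈ kids r → Valid (suc n) g r′
  child-valid (Z rs) v (here refl) = zero-child-Z v refl
  child-valid (Z rs) v (there h) with ∈-map⁻ zKid h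
  ... | _ , h′ , refl = right-child-Z v h′
  child-valid (A ms m b rs) v (here refl) = zero-child v refl
  child-valid (A ms m b rs) v (there h) with ∈-++⁻ (map (middleKid m b) (tails⁺ ms)) h
  ... | inj₁ h′ with ∈-map⁻ (middleKid m b) h′
  ... | _ , h″ , refl = middle-child v h″
  child-valid (A ms m true rs) v (there h) | inj₂ (here refl) = m-child-true v refl refl
  child-valid (A ms m false rs) v (there h) | inj₂ (here refl) = m-child-false v refl refl
  child-valid (A ms m b rs) v (there h) | inj₂ (there h′) with ∈-map⁻ (rightKid ms m) h′
  ... | ((_ , _ , true)  , _) , h″ , refl = right-child-true v h″ refl
  ... | ((_ , _ , false) , _) , h″ , refl = right-child-false v h″ refl

-- Permutations as words

-- The constant default past the end lets the equation for old letters of an insertion hold for all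
-- i, without a bound.
val : ∀ {m n} → Vec (Fin m) n → ℕ → ℕ
val []      _       = 0
val (x ∷ w) zero    = toℕ x
val (x ∷ w) (suc i) = val w i

val-toℕ : ∀ {m n} (w : Vec (Fin m) n) i → val w (toℕ i) ≡ toℕ (lookup w i)
val-toℕ (x ∷ w) F.zero    = refl
val-toℕ (x ∷ w) (F.suc i) = val-toℕ w i

val-fromℕ< : ∀ {m n} (w : Vec (Fin m) n) {i} (i<n : i < n) → toℕ (lookup w (fromℕ< i<n)) ≡ val w i
val-fromℕ< w i<n = trans (sym (val-toℕ w (fromℕ< i<n))) (cong (val w) (F.toℕ-fromℕ< i<n))

val-< : ∀ {m n} (w : Vec (Fin m) n) {i} → i < n → val w i < m
val-< w i<n = subst (_< _) (val-fromℕ< w i<n) (F.toℕ<n _)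

val-injective : ∀ {m n} (u w : Vec (Fin m) n) → (∀ {i} → i < n → val u i ≡ val w i) → u ≡ w
val-injective []      []      _  = refl
val-injective (x ∷ u) (y ∷ w) eq with F.toℕ-injective (eq z<s) | val-injective u w (eq ∘ s<s)
... | refl | refl = refl

insert : ∀ {n} {X : Set} → ℕ → X → Vec X n → Vec X (suc n)
insert zero    x w       = x ∷ w
insert (suc p) x []      = x ∷ []
insert (suc p) x (y ∷ w) = y ∷ insert p x w

val-insert-new : ∀ {m n p} {x : Fin m} (w : Vec (Fin m) n) → p ≤ n → val (insert p x w) p ≡ toℕ x
val-insert-new {p = zero}  w       _         = refl
val-insert-new {p = suc p} (y ∷ w) (s≤s p≤n) = val-insert-new w p≤n

val-insert-old : ∀ {m n p} {x : Fin m} (w : Vec (Fin m) n) → p ≤ n → ∀ i → val (insert p x w) (up p i) ≡ val w i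
val-insert-old {p = zero}  w       _         i       = refl
val-insert-old {p = suc p} (y ∷ w) (s≤s p≤n) zero    = refl
val-insert-old {p = suc p} (y ∷ w) (s≤s p≤n) (suc i) = val-insert-old w p≤n i

val-inject₁ : ∀ {m n} (w : Vec (Fin m) n) i → val (Vec.map inject₁ w) i ≡ val w i
val-inject₁ []      i       = refl
val-inject₁ (x ∷ w) zero    = F.toℕ-inject₁ x
val-inject₁ (x ∷ w) (suc i) = val-inject₁ w i

insertMax : ∀ {n} → ℕ → Vec (Fin n) n → Vec (Fin (suc n)) (suc n)
insertMax {n} p w = insert p (fromℕ n) (Vec.map inject₁ w)

module _ {n p : ℕ} (p≤n : p ≤ n) (w : Vec (Fin n) n) where

  insertMax-new : val (insertMax p w) p ≡ n
  insertMax-new = trans (val-insert-new (Vec.map inject₁ w) p≤n) (F.toℕ-fromℕ n)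

  insertMax-old : ∀ i → val (insertMax p w) (up p i) ≡ val w i
  insertMax-old i = trans (val-insert-old (Vec.map inject₁ w) p≤n i) (val-inject₁ w i)

  open Insertion {f = val w} {val (insertMax p w)} p≤n (val-< w) insertMax-new insertMax-old public
  open Children {f = val w} {val (insertMax p w)} p≤n (val-< w) insertMax-new insertMax-old public

-- The letter n occurs only where it was inserted, so its position recovers the site, and the
-- remaining positions recover the word.
insertMax-injective : ∀ {n p q} (w w′ : Vec (Fin n) n) → p ≤ n → q ≤ n →
                      insertMax p w ≡ insertMax q w′ → p ≡ q × w ≡ w′
insertMax-injective {n} {p} {q} w w′ p≤n q≤n eq with position q p in e
... | new = refl , val-injective w w′ λ {i} _ →
  trans (sym (insertMax-old p≤n w i)) (trans (cong (λ u → val u (up p i)) eq) (insertMax-old q≤n w′ i))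
... | old i = ⊥-elim (<-irrefl (trans (sym (insertMax-old q≤n w′ i)) (trans (cong (λ u → val u (up q i)) (sym eq)) (insertMax-new p≤n w)))
                               (val-< w′ (up-<ʳ⁻¹ q≤n (s≤s p≤n))))

Inj : ℕ → (ℕ → ℕ) → Set
Inj n f = ∀ {i j} → i < n → j < n → f i ≡ f j → i ≡ j

isPerm⇒inj : ∀ {n} (w : Vec (Fin n) n) → IsPerm w → Inj n (val w)
isPerm⇒inj w perm i<n j<n eq =
  trans (sym (F.toℕ-fromℕ< i<n)) (trans (cong toℕ (perm _ _ (F.toℕ-injective
    (trans (val-fromℕ< w i<n) (trans eq (sym (val-fromℕ< w j<n))))))) (F.toℕ-fromℕ< j<n))

inj⇒isPerm : ∀ {n} (w : Vec (Fin n) n) → Inj n (val w) → IsPerm w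
inj⇒isPerm w inj i j eq =
  F.toℕ-injective (inj (F.toℕ<n i) (F.toℕ<n j) (trans (val-toℕ w i) (trans (cong toℕ eq) (sym (val-toℕ w j)))))

inj-insert : ∀ {n p} (p≤n : p ≤ n) (w : Vec (Fin n) n) → Inj n (val w) → Inj (suc n) (val (insertMax p w))
inj-insert {n} {p} p≤n w inj {i} {j} i<n j<n eq with position p i | position p j
... | new | new = refl
... | new | old j = ⊥-elim (<-irrefl (trans (sym (insertMax-old p≤n w j)) (trans (sym eq) (insertMax-new p≤n w))) (val-< w (up-<ʳ⁻¹ p≤n j<n)))
... | old i | new = ⊥-elim (<-irrefl (trans (sym (insertMax-old p≤n w i)) (trans eq (insertMax-new p≤n w))) (val-< w (up-<ʳ⁻¹ p≤n i<n)))
... | old i | old j =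
  cong (up p) (inj (up-<ʳ⁻¹ p≤n i<n) (up-<ʳ⁻¹ p≤n j<n) (trans (sym (insertMax-old p≤n w i)) (trans eq (insertMax-old p≤n w j))))

up-injective : ∀ p {i j} → up p i ≡ up p j → i ≡ j
up-injective p {i} {j} eq with <-cmp i j
... | tri< i<j _ _ = ⊥-elim (<-irrefl eq (up-mono-< p i<j))
... | tri≈ _ i≡j _ = i≡j
... | tri> _ _ j<i = ⊥-elim (<-irrefl (sym eq) (up-mono-< p j<i))

inj-insert⁻¹ : ∀ {n p} (p≤n : p ≤ n) (w : Vec (Fin n) n) → Inj (suc n) (val (insertMax p w)) → Inj n (val w)
inj-insert⁻¹ {n} {p} p≤n w inj {i} {j} i<n j<n eq =
  up-injective p (inj (up-<ʳ p≤n i<n) (up-<ʳ p≤n j<n)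
    (trans (insertMax-old p≤n w i) (trans eq (sym (insertMax-old p≤n w j)))))

val-tabulate : ∀ {m n} (h : Fin n → Fin m) {i} (i<n : i < n) → val (tabulate h) i ≡ toℕ (h (fromℕ< i<n))
val-tabulate {n = suc n} h {zero}  _         = refl
val-tabulate {n = suc n} h {suc i} (s<s i<n) = val-tabulate (h ∘ F.suc) i<n

-- If n were missing, punching it out would map n + 1 positions to n values, and the pigeonhole
-- principle would give two equal letters.
max-occurs : ∀ {n} (u : Vec (Fin (suc n)) (suc n)) → IsPerm u → ∃ λ i → lookup u i ≡ fromℕ n
max-occurs {n} u perm with F.any? (λ i → lookup u i F.≟ fromℕ n)
... | yes h = h
... | no ¬h with F.pigeonhole (n<1+n n) (λ i → punchOut {i = fromℕ n} (λ eq → ¬h (i , sym eq)))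
... | i , j , i<j , eq = ⊥-elim (<-irrefl (cong toℕ (perm i j (F.punchOut-injective {i = fromℕ n} _ _ eq))) i<j)

up-≢ : ∀ p i → up p i ≢ p
up-≢ zero    i       ()
up-≢ (suc p) zero    ()
up-≢ (suc p) (suc i) eq = up-≢ p i (suc-injective eq)

perm-insertMax : ∀ {n} (u : Vec (Fin (suc n)) (suc n)) → IsPerm u → ∃ λ p → p ≤ n × ∃ λ w → u ≡ insertMax p w
perm-insertMax {n} u perm = p , p≤n , w , val-injective u (insertMax p w) same
  where
  imax = max-occurs u perm
  p = toℕ (proj₁ imax)
  p≤n : p ≤ n
  p≤n = ≤-pred (F.toℕ<n (proj₁ imax))
  val-p : val u p ≡ n
  val-p = trans (val-toℕ u (proj₁ imax)) (trans (cong toℕ (proj₂ imax)) (F.toℕ-fromℕ n))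
  old<n : ∀ {i} → i < n → val u (up p i) < n
  old<n {i} i<n = ≤∧≢⇒< (≤-pred (val-< u (up-<ʳ p≤n i<n)))
    λ eq → up-≢ p i (isPerm⇒inj u perm (up-<ʳ p≤n i<n) (s≤s p≤n) (trans eq (sym val-p)))
  w : Vec (Fin n) n
  w = tabulate λ j → fromℕ< (old<n (F.toℕ<n j))
  same : ∀ {i} → i < suc n → val u i ≡ val (insertMax p w) i
  same {i} i<n with position p i
  ... | new = trans val-p (sym (insertMax-new p≤n w))
  ... | old j = sym (trans (insertMax-old p≤n w j) (trans (val-tabulate _ (up-<ʳ⁻¹ p≤n i<n))
    (trans (F.toℕ-fromℕ< _) (cong (val u ∘ up p) (F.toℕ-fromℕ< (up-<ʳ⁻¹ p≤n i<n))))))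

-- Pattern containment as inequalities at four positions

mono₄ : (h : Fin 4 → ℕ) → h 0F < h 1F → h 1F < h 2F → h 2F < h 3F → ∀ {a b} → a F.< b → h a < h b
mono₄ h h₀₁ h₁₂ h₂₃ {0F} {1F} _ = h₀₁
mono₄ h h₀₁ h₁₂ h₂₃ {0F} {2F} _ = <-trans h₀₁ h₁₂
mono₄ h h₀₁ h₁₂ h₂₃ {0F} {3F} _ = <-trans h₀₁ (<-trans h₁₂ h₂₃)
mono₄ h h₀₁ h₁₂ h₂₃ {1F} {2F} _ = h₁₂
mono₄ h h₀₁ h₁₂ h₂₃ {1F} {3F} _ = <-trans h₁₂ h₂₃
mono₄ h h₀₁ h₁₂ h₂₃ {2F} {3F} _ = h₂₃
mono₄ h h₀₁ h₁₂ h₂₃ {1F} {1F} (s≤s ())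
mono₄ h h₀₁ h₁₂ h₂₃ {2F} {1F} (s≤s ())
mono₄ h h₀₁ h₁₂ h₂₃ {2F} {2F} (s≤s (s≤s ()))
mono₄ h h₀₁ h₁₂ h₂₃ {3F} {1F} (s≤s ())
mono₄ h h₀₁ h₁₂ h₂₃ {3F} {2F} (s≤s (s≤s ()))
mono₄ h h₀₁ h₁₂ h₂₃ {3F} {3F} (s≤s (s≤s (s≤s ())))

-- The three patterns are involutions, so that τ also lists the positions of the letters by size.
contains : ∀ {n} (w : Vec (Fin n) n) (τ : Vec (Fin 4) 4) → (∀ a → lookup τ (lookup τ a) ≡ a) →
           ∀ {i j k l} → i < j → j < k → k < l → l < n →
           (let x r = val w (Vec.lookup (i ∷ j ∷ k ∷ l ∷ []) (lookup τ r))) →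
           x 0F < x 1F → x 1F < x 2F → x 2F < x 3F → Contains w τ
contains {n} w τ inv {i} {j} {k} {l} i<j j<k k<l l<n h₀₁ h₁₂ h₂₃ = ι , ι-mono , order
  where
  pos : Vec ℕ 4
  pos = i ∷ j ∷ k ∷ l ∷ []
  pos-mono : ∀ {a b} → a F.< b → lookup pos a < lookup pos b
  pos-mono = mono₄ (lookup pos) i<j j<k k<l
  pos<n : ∀ a → lookup pos a < n
  pos<n 0F = <-trans i<j (<-trans j<k (<-trans k<l l<n))
  pos<n 1F = <-trans j<k (<-trans k<l l<n)
  pos<n 2F = <-trans k<l l<n
  pos<n 3F = l<n
  ι : Fin 4 → Fin n
  ι a = fromℕ< (pos<n a)
  ι-mono : ∀ a b → a F.< b → ι a F.< ι b
  ι-mono a b a<b = subst₂ _<_ (sym (F.toℕ-fromℕ< _)) (sym (F.toℕ-fromℕ< _)) (pos-mono a<b)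
  x : Fin 4 → ℕ
  x r = val w (lookup pos (lookup τ r))
  letter : ∀ a → x (lookup τ a) ≡ toℕ (lookup w (ι a))
  letter a = trans (cong (val w ∘ lookup pos) (inv a)) (sym (val-fromℕ< w (pos<n a)))
  x-mono : ∀ {r s} → r F.< s → x r < x s
  x-mono = mono₄ x h₀₁ h₁₂ h₂₃
  x-cancel : ∀ {r s} → x r < x s → r F.< s
  x-cancel {r} {s} h with F.<-cmp r s
  ... | tri< r<s _ _ = r<s
  ... | tri≈ _ refl _ = ⊥-elim (<-irrefl refl h)
  ... | tri> _ _ s<r = ⊥-elim (<-asym h (x-mono s<r))
  order : ∀ a b → (lookup τ a F.< lookup τ b) ⇔ (lookup w (ι a) F.< lookup w (ι b))
  order a b = mk⇔ (λ h → subst₂ _<_ (letter a) (letter b) (x-mono h))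
                  (λ h → x-cancel (subst₂ _<_ (sym (letter a)) (sym (letter b)) h))

module _ {n} (w : Vec (Fin n) n) where

  private
    letter< : ∀ {τ : Vec (Fin 4) 4} (c : Contains w τ) a b → lookup τ a F.< lookup τ b →
              val w (toℕ (proj₁ c a)) < val w (toℕ (proj₁ c b))
    letter< (ι , _ , order) a b h =
      subst₂ _<_ (sym (val-toℕ w (ι a))) (sym (val-toℕ w (ι b))) (Equivalence.to (order a b) h)

    position< : ∀ {τ : Vec (Fin 4) 4} (c : Contains w τ) a b → a F.< b → toℕ (proj₁ c a) < toℕ (proj₁ c b)
    position< (_ , mono , _) a b = mono a b

    0<1 : 0 < 1
    0<1 = z<s

    1<2 : 1 < 2
    1<2 = s<s 0<1

    2<3 : 2 < 3
    2<3 = s<s 1<2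

  avoiding⇒avoids : Avoiding n (val w) → Avoids w p1432 × Avoids w p2143 × Avoids w p3214
  avoiding⇒avoids (avoiding no1432 no2143 no3214) =
    (λ c → no1432 (position< {p1432} c 0F 1F 0<1) (position< {p1432} c 1F 2F 1<2) (position< {p1432} c 2F 3F 2<3)
      (F.toℕ<n (proj₁ c 3F)) (letter< {p1432} c 0F 3F 0<1) (letter< {p1432} c 3F 2F 1<2) (letter< {p1432} c 2F 1F 2<3)) ,
    (λ c → no2143 (position< {p2143} c 0F 1F 0<1) (position< {p2143} c 1F 2F 1<2) (position< {p2143} c 2F 3F 2<3)
      (F.toℕ<n (proj₁ c 3F)) (letter< {p2143} c 1F 0F 0<1) (letter< {p2143} c 0F 3F 1<2) (letter< {p2143} c 3F 2F 2<3)) ,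
    (λ c → no3214 (position< {p3214} c 0F 1F 0<1) (position< {p3214} c 1F 2F 1<2) (position< {p3214} c 2F 3F 2<3)
      (F.toℕ<n (proj₁ c 3F)) (letter< {p3214} c 2F 1F 0<1) (letter< {p3214} c 1F 0F 1<2) (letter< {p3214} c 0F 3F 2<3))

  avoids⇒avoiding : Avoids w p1432 × Avoids w p2143 × Avoids w p3214 → Avoiding n (val w)
  avoids⇒avoiding (av1432 , av2143 , av3214) = avoiding
    (λ i<j j<k k<l l<n x y z → av1432 (contains w p1432 (λ { 0F → refl ; 1F → refl ; 2F → refl ; 3F → refl }) i<j j<k k<l l<n x y z))
    (λ i<j j<k k<l l<n x y z → av2143 (contains w p2143 (λ { 0F → refl ; 1F → refl ; 2F → refl ; 3F → refl }) i<j j<k k<l l<n x y z))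
    (λ i<j j<k k<l l<n x y z → av3214 (contains w p3214 (λ { 0F → refl ; 1F → refl ; 2F → refl ; 3F → refl }) i<j j<k k<l l<n x y z))

inSnT-insert : ∀ {n p} (p≤n : p ≤ n) (w : Vec (Fin n) n) → InSnT n w → Active n (val w) p → InSnT (suc n) (insertMax p w)
inSnT-insert {n} {p} p≤n w (perm , av) act =
  inj⇒isPerm (insertMax p w) (inj-insert p≤n w (isPerm⇒inj w perm)) ,
  avoiding⇒avoids (insertMax p w) (avoiding-insert p≤n w (avoids⇒avoiding w av) act)

inSnT-insert⁻¹ : ∀ {n p} (p≤n : p ≤ n) (w : Vec (Fin n) n) → InSnT (suc n) (insertMax p w) → InSnT n w × Active n (val w) p
inSnT-insert⁻¹ {n} {p} p≤n w (perm , av) =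
  let av′ , act = avoiding-insert⁻¹ p≤n w (avoids⇒avoiding (insertMax p w) av)
  in (inj⇒isPerm w (inj-insert⁻¹ p≤n w (isPerm⇒inj (insertMax p w) perm)) , avoiding⇒avoids w av′) , act

-- The levels of the tree enumerate the avoiders

sites : Node → List ℕ
sites (Z rs)        = 0 ∷ rs
sites (A ms m b rs) = 0 ∷ ms ++ m ∷ map proj₁ rs

map-site-tails⁺ : ∀ {X : Set} (site : X → ℕ) (kid : X × List X → ℕ × Node) →
                  (∀ x post → proj₁ (kid (x , post)) ≡ site x) → ∀ xs →
                  map proj₁ (map kid (tails⁺ xs)) ≡ map site xs
map-site-tails⁺ site kid eq []       = refl
map-site-tails⁺ site kid eq (x ∷ xs) rewrite eq x xs = cong (site x ∷_) (map-site-tails⁺ site kid eq xs)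

map-proj₁-kids : ∀ r → map proj₁ (kids r) ≡ sites r
map-proj₁-kids (Z rs) = cong (0 ∷_) (trans (map-site-tails⁺ id zKid (λ _ _ → refl) rs) (map-id rs))
map-proj₁-kids (A ms m b rs) = cong (0 ∷_) (trans (map-++ proj₁ (map (middleKid m b) (tails⁺ ms)) _)
  (cong₂ _++_ (trans (map-site-tails⁺ id (middleKid m b) (λ _ _ → refl) ms) (map-id ms))
              (cong₂ _∷_ (mKid-site b) (map-site-tails⁺ proj₁ (rightKid ms m) rightKid-site rs))))
  where
  mKid-site : ∀ b → proj₁ (mKid ms m b rs) ≡ m
  mKid-site true  = refl
  mKid-site false = refl
  rightKid-site : ∀ e post → proj₁ (rightKid ms m (e , post)) ≡ proj₁ e
  rightKid-site (_ , _ , true)  _ = refl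
  rightKid-site (_ , _ , false) _ = refl

site-active : ∀ {n f} r → Valid n f r → ∀ {q} → q ∈ sites r → q ≤ n × Active n f q
site-active (Z rs) v (here refl) = z≤n , ValidZ.act-zero v
site-active (Z rs) v (there q∈) = let act , _ , q≤n , _ = ValidZ.rights v q∈ in q≤n , act
site-active (A ms m b rs) v (here refl) = z≤n , ValidA.act-zero v
site-active (A ms m b rs) v (there q∈) with ∈-++⁻ ms q∈
... | inj₁ h = let act , _ , q<m = ValidA.middle v h in ≤-trans (<⇒≤ q<m) (ValidA.m≤n v) , act
... | inj₂ (here refl) = ValidA.m≤n v , ValidA.act-m v
... | inj₂ (there h) with ∈-map⁻ proj₁ h
... | e , e∈ , refl = let s = ValidA.rights v e∈ in RightSite.q≤n s , RightSite.act s

active-site : ∀ {n f} r → Valid n f r → ∀ {q} → q ≤ n → Active n f q → q ∈ sites r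
active-site (Z rs) v q≤n act = ValidZ.complete v q≤n act
active-site (A ms m b rs) v q≤n act with ValidA.complete v q≤n act
... | inj₁ (here refl) = here refl
... | inj₁ (there (here refl)) = there (∈-++⁺ʳ ms (here refl))
... | inj₁ (there (there h)) = there (∈-++⁺ˡ h)
... | inj₂ h = there (∈-++⁺ʳ ms (there h))

sites-sorted : ∀ {n f} r → Valid n f r → AllPairs _<_ (sites r)
sites-sorted (Z rs) v =
  All.tabulate (λ q∈ → proj₁ (proj₂ (ValidZ.rights v q∈))) ∷ AllPairs.map proj₁ (ValidZ.sorted v)
sites-sorted (A ms m b rs) v =
  All.++⁺ (All.tabulate λ x∈ → proj₁ (proj₂ (middle x∈))) (0<m ∷ All.map⁺ (All.tabulate λ e∈ → <-trans 0<m (m<q (rights e∈)))) ∷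
  AllPairs.++⁺ sortedᵐ (All.map⁺ (All.tabulate λ e∈ → m<q (rights e∈)) ∷ AllPairs.map⁺ (AllPairs.map proj₁ sortedʳ))
    (All.tabulate λ x∈ → let x<m = proj₂ (proj₂ (middle x∈)) in
      x<m ∷ All.map⁺ (All.tabulate λ e∈ → <-trans x<m (m<q (rights e∈))))
  where open ValidA v ; open RightSite using (m<q)

State : ℕ → Set
State n = Vec (Fin n) n × Node

children : ∀ {n} → State n → List (State (suc n))
children (w , r) = map (λ (p , r′) → insertMax p w , r′) (kids r)

level : ∀ n → List (State n)
level zero    = ([] , Z []) ∷ []
level (suc n) = concatMap children (level n)

Sound : ∀ {n} → State n → Set
Sound {n} (w , r) = InSnT n w × Valid n (val w) r

kid-site : ∀ {p r′} r → (p , r′) ∈ kids r → p ∈ sites r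
kid-site r h = subst (_ ∈_) (map-proj₁-kids r) (∈-map⁺ proj₁ h)

child-sound : ∀ {n} {s : State n} → Sound s → All Sound (children s)
child-sound {n} {w , r} (inS , v) = All.map⁺ (All.tabulate λ {(p , r′)} h →
  let p≤n , act = site-active r v (kid-site r h)
  in inSnT-insert p≤n w inS act , child-valid p≤n w r v h)

level-sound : ∀ n → All Sound (level n)
level-sound zero = (((λ ()) , avoiding⇒avoids [] (avoiding (λ _ _ _ ()) (λ _ _ _ ()) (λ _ _ _ ()))) , record
  { act-zero = active (λ _ _ ()) (λ _ ()) (λ ())
  ; rights = λ ()
  ; complete = λ { z≤n _ → here refl }
  ; sorted = []
  }) ∷ []
level-sound (suc n) = All.concat⁺ (All.map⁺ (All.map child-sound (level-sound n)))

-- Deleting the maximum stays inside the class and leaves an active site, which the valid node of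
-- the parent must list.
level-complete : ∀ n w → InSnT n w → ∃ λ r → (w , r) ∈ level n
level-complete zero [] _ = Z [] , here refl
level-complete (suc n) u inS with perm-insertMax u (proj₁ inS)
... | p , p≤n , w , refl =
  let inS′ , act = inSnT-insert⁻¹ p≤n w inS
      r , h = level-complete n w inS′
      _ , v = All.lookup (level-sound n) h
      (_ , r′) , h′ , eq = ∈-map⁻ proj₁ (subst (p ∈_) (sym (map-proj₁-kids r)) (active-site r v p≤n act))
  in r′ , ∈-concatMap⁺ children (Any.map (λ { refl → child h′ eq }) h)
  where
  child : ∀ {r p′ r′} → (p′ , r′) ∈ kids r → p ≡ p′ → (insertMax p w , r′) ∈ children (w , r)
  child h refl = ∈-map⁺ _ h

-- A word determines both its parent and the site of its maximum: siblings differ in the site,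
-- cousins in the parent.
level-unique : ∀ n → AllPairs (λ s t → proj₁ s ≢ proj₁ t) (level n)
level-unique zero    = [] ∷ []
level-unique (suc n) = AllPairs.concat⁺ (All.map⁺ (All.map siblings (level-sound n)))
  (AllPairs.map⁺ (cousins (level-sound n) (level-unique n)))
  where
  siblings : ∀ {s} → Sound s → AllPairs (λ s t → proj₁ s ≢ proj₁ t) (children s)
  siblings {w , r} (_ , v) = AllPairs.map⁺ (distinct (kids r) (λ h → proj₁ (site-active r v (kid-site r h)))
    (subst (AllPairs _<_) (sym (map-proj₁-kids r)) (sites-sorted r v)))
    where
    distinct : ∀ xs → (∀ {x} → x ∈ xs → proj₁ x ≤ n) → AllPairs _<_ (map proj₁ xs) →
               AllPairs (λ x y → insertMax (proj₁ x) w ≢ insertMax (proj₁ y) w) xs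
    distinct [] _ _ = []
    distinct (x ∷ xs) ≤n (lt ∷ lts) =
      All.tabulate (λ y∈ eq → <-irrefl (proj₁ (insertMax-injective w w (≤n (here refl)) (≤n (there y∈)) eq))
                                         (All.lookup lt (∈-map⁺ proj₁ y∈))) ∷
      distinct xs (≤n ∘ there) lts
  cousins : ∀ {ss} → All Sound ss → AllPairs (λ s t → proj₁ s ≢ proj₁ t) ss →
            AllPairs (λ s t → All (λ x → All (λ y → proj₁ x ≢ proj₁ y) (children t)) (children s)) ss
  cousins [] [] = []
  cousins {(w , r) ∷ _} ((_ , v) ∷ vs) (d ∷ ds) =
    All.tabulate (λ {(w′ , r′)} t∈ →
      All.map⁺ (All.tabulate λ h → All.map⁺ (All.tabulate λ h′ eq →
        All.lookup d t∈ (proj₂ (insertMax-injective w w′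
          (proj₁ (site-active r v (kid-site r h)))
          (proj₁ (site-active r′ (proj₂ (All.lookup vs t∈)) (kid-site r′ h′))) eq))))) ∷
    cousins vs ds

hasSize-level : ∀ n → HasSize (InSnT n) (length (level n))
hasSize-level n = map proj₁ (level n) , AllPairs.map⁺ (level-unique n) , (λ w → mk⇔ (to w) (from w)) , length-map proj₁ (level n)
  where
  to : ∀ w → w ∈ map proj₁ (level n) → InSnT n w
  to w w∈ with ∈-map⁻ proj₁ w∈
  ... | _ , h , refl = proj₁ (All.lookup (level-sound n) h)
  from : ∀ w → InSnT n w → w ∈ map proj₁ (level n)
  from w inS = ∈-map⁺ proj₁ (proj₂ (level-complete n w inS))

-- Counting by shapes

data Shape : Set where
  Z : ℕ → Shape
  A : ℕ → Bool → List (Bool × Bool) → Shape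

shape : Node → Shape
shape (Z rs)        = Z (length rs)
shape (A ms m b rs) = A (length ms) b (map proj₂ rs)

middleShapes : ℕ → Bool → List Shape
middleShapes zero    b = []
middleShapes (suc k) b = A 0 false (replicate k (true , false) ∷ʳ (true , b)) ∷ middleShapes k b

keepFlags : List (Bool × Bool) → List (Bool × Bool)
keepFlags []                 = []
keepFlags ((true  , g) ∷ fs) = (true , g) ∷ keepFlags fs
keepFlags ((false , g) ∷ fs) = keepFlags fs

mShape : ℕ → Bool → List (Bool × Bool) → Shape
mShape a true  fs = A (suc a) true (keepFlags fs)
mShape a false fs = A 0 false (keepFlags fs)

rightShapes : ℕ → List (Bool × Bool) → List Shape
rightShapes a []                 = []
rightShapes a ((t , true)  ∷ fs) = A a false ((t , true) ∷ map (const (false , true)) fs) ∷ rightShapes a fs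
rightShapes a ((t , false) ∷ fs) = Z (suc (length fs)) ∷ rightShapes a fs

zShapes : ℕ → List Shape
zShapes zero    = []
zShapes (suc k) = Z (suc k) ∷ zShapes k

kidShapes : Shape → List Shape
kidShapes (Z k)      = A 0 true [] ∷ zShapes k
kidShapes (A a b fs) =
  A 0 true (replicate (suc a) (true , true)) ∷ middleShapes a b ++ mShape a b fs ∷ rightShapes a fs

map-const : ∀ {X Y : Set} (y : Y) (xs : List X) → map (const y) xs ≡ replicate (length xs) y
map-const y []       = refl
map-const y (x ∷ xs) = cong (y ∷_) (map-const y xs)

length-∷ʳ : ∀ {X : Set} (xs : List X) {x : X} → length (xs ∷ʳ x) ≡ suc (length xs)
length-∷ʳ []       = refl
length-∷ʳ (_ ∷ xs) = cong suc (length-∷ʳ xs)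

map-proj₂-flagged : ∀ {X : Set} (h : X → Right) {t g} → (∀ x → proj₂ (h x) ≡ (t , g)) → ∀ xs →
                    map proj₂ (map h xs) ≡ replicate (length xs) (t , g)
map-proj₂-flagged h eq xs = trans (sym (map-∘ xs)) (trans (map-cong eq xs) (map-const _ xs))

-- `kids` moves positions around but computes the flags of a child from flags and list lengths
-- alone.
shape-kids : ∀ r → map (shape ∘ proj₂) (kids r) ≡ kidShapes (shape r)
shape-kids (Z rs) = cong (A 0 true [] ∷_) (go rs)
  where
  go : ∀ rs → map (shape ∘ proj₂) (map zKid (tails⁺ rs)) ≡ zShapes (length rs)
  go []       = refl
  go (q ∷ rs) = cong₂ (λ l ss → Z (suc l) ∷ ss) (length-map suc rs) (go rs)
shape-kids (A ms m b rs) = cong₂ _∷_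
  (cong (A 0 true) (trans (map-proj₂-flagged (flagged true true) (λ _ → refl) (ms ∷ʳ m))
                          (cong (λ l → replicate l (true , true)) (length-∷ʳ ms))))
  (trans (map-++ (shape ∘ proj₂) (map (middleKid m b) (tails⁺ ms)) _)
         (cong₂ _++_ (middles ms) (cong₂ _∷_ (main b) (rights rs))))
  where
  middles : ∀ xs → map (shape ∘ proj₂) (map (middleKid m b) (tails⁺ xs)) ≡ middleShapes (length xs) b
  middles []       = refl
  middles (x ∷ xs) = cong₂ (λ fs ss → A 0 false fs ∷ ss)
    (trans (map-++ proj₂ (map (flagged true false) xs) (flagged true b m ∷ []))
           (cong (_∷ʳ (true , b)) (map-proj₂-flagged (flagged true false) (λ _ → refl) xs)))
    (middles xs)
  kept : ∀ es → map proj₂ (keep es) ≡ keepFlags (map proj₂ es)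
  kept []                      = refl
  kept ((_ , true  , g) ∷ es) = cong ((true , g) ∷_) (kept es)
  kept ((_ , false , g) ∷ es) = kept es
  main : ∀ b → shape (proj₂ (mKid ms m b rs)) ≡ mShape (length ms) b (map proj₂ rs)
  main true  = cong₂ (λ a fs → A a true fs) (length-∷ʳ ms) (kept rs)
  main false = cong (A 0 false) (kept rs)
  rights : ∀ es → map (shape ∘ proj₂) (map (rightKid ms m) (tails⁺ es)) ≡ rightShapes (length ms) (map proj₂ es)
  rights []                     = refl
  rights ((q , t , true)  ∷ es) = cong₂ (λ fs ss → A (length ms) false ((t , true) ∷ fs) ∷ ss)
    (trans (sym (map-∘ es)) (map-∘ es)) (rights es)
  rights ((q , t , false) ∷ es) = cong₂ (λ l ss → Z (suc l) ∷ ss)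
    (trans (length-map (suc ∘ proj₁) es) (sym (length-map proj₂ es))) (rights es)

total : ∀ {X : Set} → (X → ℤ) → List X → ℤ
total f []       = + 0
total f (x ∷ xs) = f x + total f xs

total-++ : ∀ {X : Set} (f : X → ℤ) xs ys → total f (xs ++ ys) ≡ total f xs + total f ys
total-++ f []       ys = sym (+-identityˡ _)
total-++ f (x ∷ xs) ys = trans (cong (λ t → f x + t) (total-++ f xs ys)) (sym (+-assoc (f x) _ _))

total-map : ∀ {X Y : Set} (f : Y → ℤ) (h : X → Y) xs → total f (map h xs) ≡ total (f ∘ h) xs
total-map f h []       = refl
total-map f h (x ∷ xs) = cong (λ t → f (h x) + t) (total-map f h xs)

total-concatMap : ∀ {X Y : Set} (f : Y → ℤ) (h : X → List Y) xs →
                  total f (concatMap h xs) ≡ total (total f ∘ h) xs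
total-concatMap f h []       = refl
total-concatMap f h (x ∷ xs) =
  trans (total-++ f (h x) (concatMap h xs)) (cong (λ t → total f (h x) + t) (total-concatMap f h xs))

total-cong : ∀ {X : Set} {f g : X → ℤ} → (∀ x → f x ≡ g x) → ∀ xs → total f xs ≡ total g xs
total-cong eq []       = refl
total-cong eq (x ∷ xs) = cong₂ _+_ (eq x) (total-cong eq xs)

descendants : Shape → ℕ → ℤ
descendants s zero    = + 1
descendants s (suc n) = total (λ s′ → descendants s′ n) (kidShapes s)

-- The sum is unchanged when one generation is traded between words and shapes. At n = 0 it counts
-- the words of a level; at k = 0 only the root shape is left.
total-level : ∀ k n → total (λ s → descendants (shape (proj₂ s)) n) (level k) ≡ descendants (Z 0) (k ℕ.+ n)
total-level zero    n = +-identityʳ _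
total-level (suc k) n = begin
  total (count n) (concatMap children (level k))
    ≡⟨ total-concatMap (count n) children (level k) ⟩
  total (total (count n) ∘ children) (level k)
    ≡⟨ total-cong kid-count (level k) ⟩
  total (count (suc n)) (level k)
    ≡⟨ total-level k (suc n) ⟩
  descendants (Z 0) (k ℕ.+ suc n)
    ≡⟨ cong (descendants (Z 0)) (ℕ.+-suc k n) ⟩
  descendants (Z 0) (suc k ℕ.+ n) ∎
  where
  open ≡-Reasoning
  count : ∀ {k} → ℕ → State k → ℤ
  count n s = descendants (shape (proj₂ s)) n
  kid-count : ∀ (s : State k) → total (count n) (children s) ≡ count (suc n) s
  kid-count (w , r) = begin
    total (count n) (children (w , r))
      ≡⟨ total-map (count n) _ (kids r) ⟩
    total (λ k → descendants (shape (proj₂ k)) n) (kids r)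
      ≡⟨ total-map (λ s → descendants s n) (shape ∘ proj₂) (kids r) ⟨
    total (λ s → descendants s n) (map (shape ∘ proj₂) (kids r))
      ≡⟨ cong (total (λ s → descendants s n)) (shape-kids r) ⟩
    descendants (shape r) (suc n) ∎

total-one : ∀ {X : Set} (xs : List X) → total (λ _ → + 1) xs ≡ + length xs
total-one []       = refl
total-one (x ∷ xs) = cong (λ t → + 1 + t) (total-one xs)

length-level : ∀ n → + length (level n) ≡ descendants (Z 0) n
length-level n = trans (sym (total-one (level n))) (trans (total-level n 0) (cong (descendants (Z 0)) (ℕ.+-identityʳ n)))

-- Recurrences for the six families of shapes

z : ℕ → ℕ → ℤ
z k = descendants (Z k)

-- `d a k` has k + 1 flags, so that the right children arising from k flags ⊥⊤ are counted by
-- `Σ< (d a) k`.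
b c d : ℕ → ℕ → ℕ → ℤ
b a k = descendants (A a true (replicate k (true , true)))
c a k = descendants (A a false ((true , true) ∷ replicate k (false , true)))
d a k = descendants (A a false (replicate (suc k) (false , true)))

m e : ℕ → ℕ → ℤ
m k = descendants (A 0 false (replicate k (true , false) ∷ʳ (true , true)))
e k = descendants (A 0 false (replicate k (true , false)))

Σ< : (ℕ → ℕ → ℤ) → ℕ → ℕ → ℤ
Σ< f zero    n = + 0
Σ< f (suc k) n = f k n + Σ< f k n

replicate-∷ʳ : ∀ {X : Set} k {x : X} → replicate k x ∷ʳ x ≡ replicate (suc k) x
replicate-∷ʳ zero    = refl
replicate-∷ʳ (suc k) = cong (_ ∷_) (replicate-∷ʳ k)

keep-FT : ∀ k → keepFlags (replicate k (false , true)) ≡ []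
keep-FT zero    = refl
keep-FT (suc k) = keep-FT k

keep-TT : ∀ k → keepFlags (replicate k (true , true)) ≡ replicate k (true , true)
keep-TT zero    = refl
keep-TT (suc k) = cong (_ ∷_) (keep-TT k)

keep-TF : ∀ k → keepFlags (replicate k (true , false)) ≡ replicate k (true , false)
keep-TF zero    = refl
keep-TF (suc k) = cong (_ ∷_) (keep-TF k)

keep-TF-TT : ∀ k → keepFlags (replicate k (true , false) ∷ʳ (true , true)) ≡ replicate k (true , false) ∷ʳ (true , true)
keep-TF-TT zero    = refl
keep-TF-TT (suc k) = cong (_ ∷_) (keep-TF-TT k)

module _ (n : ℕ) where

  private
    count : Shape → ℤ
    count s = descendants s n

    sum : List Shape → ℤ
    sum = total count

  sum-zShapes : ∀ k → sum (zShapes k) ≡ Σ< (z ∘ suc) k n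
  sum-zShapes zero    = refl
  sum-zShapes (suc k) = cong (λ t → z (suc k) n + t) (sum-zShapes k)

  sum-middle-true : ∀ a → sum (middleShapes a true) ≡ Σ< m a n
  sum-middle-true zero    = refl
  sum-middle-true (suc a) = cong (λ t → m a n + t) (sum-middle-true a)

  sum-middle-false : ∀ a → sum (middleShapes a false) ≡ Σ< (e ∘ suc) a n
  sum-middle-false zero    = refl
  sum-middle-false (suc a) =
    cong₂ (λ fs t → descendants (A 0 false fs) n + t) (replicate-∷ʳ a) (sum-middle-false a)

  sum-right-TT : ∀ a k → sum (rightShapes a (replicate k (true , true))) ≡ Σ< (c a) k n
  sum-right-TT a zero    = refl
  sum-right-TT a (suc k) =
    cong₂ (λ fs t → descendants (A a false ((true , true) ∷ fs)) n + t) (map-replicate (const (false , true)) k _) (sum-right-TT a k)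

  sum-right-FT : ∀ a k → sum (rightShapes a (replicate k (false , true))) ≡ Σ< (d a) k n
  sum-right-FT a zero    = refl
  sum-right-FT a (suc k) =
    cong₂ (λ fs t → descendants (A a false ((false , true) ∷ fs)) n + t) (map-replicate (const (false , true)) k _) (sum-right-FT a k)

  sum-right-TF : ∀ a k → sum (rightShapes a (replicate k (true , false))) ≡ Σ< (z ∘ suc) k n
  sum-right-TF a zero    = refl
  sum-right-TF a (suc k) =
    cong₂ (λ l t → descendants (Z (suc l)) n + t) (length-replicate k) (sum-right-TF a k)

  -- The final ⊤⊤ stands behind each ⊤⊥ site, so the Z-children have at least two right sites; the
  -- ⊤⊤ site itself yields M 0.
  sum-right-TF-TT : ∀ k → sum (rightShapes 0 (replicate k (true , false) ∷ʳ (true , true))) ≡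
                    Σ< (z ∘ suc ∘ suc) k n + m 0 n
  sum-right-TF-TT zero    = ℤ.+-comm (m 0 n) (+ 0)
  sum-right-TF-TT (suc k) = trans
    (cong₂ (λ l t → descendants (Z (suc l)) n + t)
      (trans (length-∷ʳ (replicate k _)) (cong suc (length-replicate k))) (sum-right-TF-TT k))
    (sym (+-assoc (z (suc (suc k)) n) _ _))

  z-suc : ∀ k → z k (suc n) ≡ b 0 0 n + Σ< (z ∘ suc) k n
  z-suc k = cong (λ t → b 0 0 n + t) (sum-zShapes k)

  b-suc : ∀ a k → b a k (suc n) ≡ b 0 (suc a) n + (Σ< m a n + (b (suc a) k n + Σ< (c a) k n))
  b-suc a k = cong (λ t → b 0 (suc a) n + t) (trans (total-++ count (middleShapes a true) (mShape a true (replicate k (true , true)) ∷ rightShapes a (replicate k (true , true))))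
    (cong₂ _+_ (sum-middle-true a)
      (cong₂ (λ fs t → descendants (A (suc a) true fs) n + t) (keep-TT k) (sum-right-TT a k))))

  c-suc : ∀ a k → c a k (suc n) ≡ b 0 (suc a) n + (Σ< (e ∘ suc) a n + (m 0 n + (c a k n + Σ< (d a) k n)))
  c-suc a k = cong (λ t → b 0 (suc a) n + t) (trans (total-++ count (middleShapes a false) (mShape a false ((true , true) ∷ replicate k (false , true)) ∷ rightShapes a ((true , true) ∷ replicate k (false , true))))
    (cong₂ _+_ (sum-middle-false a)
      -- Only the leading ⊤⊤ survives `keepFlags`; what is left is the shape counted by `m 0`.
      (cong₂ (λ fs t → descendants (A 0 false ((true , true) ∷ fs)) n + t) (keep-FT k)
        (cong₂ (λ fs t → descendants (A a false ((true , true) ∷ fs)) n + t) (map-replicate (const (false , true)) k _) (sum-right-FT a k)))))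

  d-suc : ∀ a k → d a k (suc n) ≡ b 0 (suc a) n + (Σ< (e ∘ suc) a n + (e 0 n + Σ< (d a) (suc k) n))
  d-suc a k = cong (λ t → b 0 (suc a) n + t) (trans (total-++ count (middleShapes a false) (mShape a false (replicate (suc k) (false , true)) ∷ rightShapes a (replicate (suc k) (false , true))))
    (cong₂ _+_ (sum-middle-false a)
      (cong₂ (λ fs t → descendants (A 0 false fs) n + t) (keep-FT k) (sum-right-FT a (suc k)))))

  m-suc : ∀ k → m k (suc n) ≡ b 0 1 n + (m k n + (Σ< (z ∘ suc ∘ suc) k n + m 0 n))
  m-suc k = cong (λ t → b 0 1 n + t)
    (cong₂ (λ fs t → descendants (A 0 false fs) n + t) (keep-TF-TT k) (sum-right-TF-TT k))

  e-suc : ∀ k → e k (suc n) ≡ b 0 1 n + (e k n + Σ< (z ∘ suc) k n)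
  e-suc k = cong (λ t → b 0 1 n + t)
    (cong₂ (λ fs t → descendants (A 0 false fs) n + t) (keep-TF k) (sum-right-TF 0 k))

-- Summation along diagonals

-- The generating function of Diag f is Σₖ xᵏ fₖ(x).
Diag : (ℕ → ℕ → ℤ) → ℕ → ℤ
Diag f zero    = f 0 0
Diag f (suc n) = f 0 (suc n) + Diag (f ∘ suc) n

Diag-cong : ∀ {f g} → (∀ k n → f k n ≡ g k n) → ∀ n → Diag f n ≡ Diag g n
Diag-cong eq zero    = eq 0 0
Diag-cong eq (suc n) = cong₂ _+_ (eq 0 (suc n)) (Diag-cong (eq ∘ suc) n)

Diag-+ : ∀ f g n → Diag (λ k n → f k n + g k n) n ≡ Diag f n + Diag g n
Diag-+ f g zero    = refl
Diag-+ f g (suc n) = trans (cong (λ t → f 0 (suc n) + g 0 (suc n) + t) (Diag-+ (f ∘ suc) (g ∘ suc) n))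
  (ring (f 0 (suc n)) (g 0 (suc n)) (Diag (f ∘ suc) n) (Diag (g ∘ suc) n))
  where
  ring : ∀ a b c d → (a + b) + (c + d) ≡ (a + c) + (b + d)
  ring = solve-∀

Diag-- : ∀ f g n → Diag (λ k n → f k n - g k n) n ≡ Diag f n - Diag g n
Diag-- f g zero    = refl
Diag-- f g (suc n) = trans (cong (λ t → f 0 (suc n) - g 0 (suc n) + t) (Diag-- (f ∘ suc) (g ∘ suc) n))
  (ring (f 0 (suc n)) (g 0 (suc n)) (Diag (f ∘ suc) n) (Diag (g ∘ suc) n))
  where
  ring : ∀ a b c d → (a - b) + (c - d) ≡ (a + c) - (b + d)
  ring = solve-∀

-- In generating functions: fₖ = gₖ + x hₖ for all k, multiplied by xᵏ and summed.
Diag-suc : ∀ f g h → (∀ k → f k 0 ≡ g k 0) → (∀ k n → f k (suc n) ≡ g k (suc n) + h k n) →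
           ∀ n → Diag f (suc n) ≡ Diag g (suc n) + Diag h n
Diag-suc f g h f₀ fₛ zero = trans (cong₂ _+_ (fₛ 0 0) (f₀ 1)) (ring (g 0 1) (h 0 0) (g 1 0))
  where
  ring : ∀ a b c → (a + b) + c ≡ (a + c) + b
  ring = solve-∀
Diag-suc f g h f₀ fₛ (suc n) =
  trans (cong₂ _+_ (fₛ 0 (suc n)) (Diag-suc (f ∘ suc) (g ∘ suc) (h ∘ suc) (f₀ ∘ suc) (fₛ ∘ suc) n))
        (ring (g 0 (suc (suc n))) (h 0 (suc n)) (Diag (g ∘ suc) (suc n)) (Diag (h ∘ suc) n))
  where
  ring : ∀ a b c d → (a + b) + (c + d) ≡ (a + c) + (b + d)
  ring = solve-∀

-- The extra 1 is the end of the diagonal, the term k = n + 1 at generation 0.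
Diag-suc-one : ∀ f h → (∀ k → f k 0 ≡ + 1) → (∀ k n → f k (suc n) ≡ h k n) →
               ∀ n → Diag f (suc n) ≡ Diag h n + + 1
Diag-suc-one f h f₀ fₛ zero    = cong₂ _+_ (fₛ 0 0) (f₀ 1)
Diag-suc-one f h f₀ fₛ (suc n) =
  trans (cong₂ _+_ (fₛ 0 (suc n)) (Diag-suc-one (f ∘ suc) (h ∘ suc) (f₀ ∘ suc) (fₛ ∘ suc) n))
        (sym (+-assoc (h 0 (suc n)) (Diag (h ∘ suc) n) (+ 1)))

-- Each unrolling raises a and lowers the generation by one, so the terms h are collected along a
-- diagonal until generation 0 leaves κ.
telescope : ∀ (y h : ℕ → ℕ → ℤ) {κ} → (∀ a → y a 0 ≡ κ) → (∀ a n → y a (suc n) ≡ h a n + y (suc a) n) →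
            ∀ n → y 0 (suc n) ≡ Diag h n + κ
telescope y h y₀ yₛ zero    = trans (yₛ 0 0) (cong (λ t → h 0 0 + t) (y₀ 1))
telescope y h {κ} y₀ yₛ (suc n) =
  trans (yₛ 0 (suc n)) (trans (cong (λ t → h 0 (suc n) + t) (telescope (y ∘ suc) (h ∘ suc) (y₀ ∘ suc) (yₛ ∘ suc) n))
                              (sym (+-assoc (h 0 (suc n)) (Diag (h ∘ suc) n) κ)))

-- The child sums for k + 1 and k share all but one term, so differencing in k replaces `Σ<` by a
-- single count. The steps for e, m, d and c use the same device.
z-step : ∀ k n → z (suc k) (suc n) ≡ z k (suc n) + z (suc k) n
z-step k n = trans (z-suc n (suc k)) (trans (ring (b 0 0 n) (z (suc k) n) (Σ< (z ∘ suc) k n)) (cong (λ t → t + z (suc k) n) (sym (z-suc n k))))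
  where
  ring : ∀ p x s → p + (x + s) ≡ (p + s) + x
  ring = solve-∀

e-step : ∀ k n → e (suc k) (suc n) ≡ e k (suc n) + ((e (suc k) n - e k n) + z (suc k) n)
e-step k n = trans (e-suc n (suc k)) (trans (ring (b 0 1 n) (e (suc k) n) (e k n) (z (suc k) n) (Σ< (z ∘ suc) k n))
  (cong (λ t → t + ((e (suc k) n - e k n) + z (suc k) n)) (sym (e-suc n k))))
  where
  ring : ∀ p x y w s → p + (x + (w + s)) ≡ (p + (y + s)) + ((x - y) + w)
  ring = solve-∀

m-step : ∀ k n → m (suc k) (suc n) ≡ m k (suc n) + ((m (suc k) n - m k n) + z (suc (suc k)) n)
m-step k n = trans (m-suc n (suc k)) (trans (ring (b 0 1 n) (m (suc k) n) (m k n) (z (suc (suc k)) n) (Σ< (λ k → z (2 ℕ.+ k)) k n) (m 0 n))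
  (cong (λ t → t + ((m (suc k) n - m k n) + z (suc (suc k)) n)) (sym (m-suc n k))))
  where
  ring : ∀ p x y w s r → p + (x + ((w + s) + r)) ≡ (p + (y + (s + r))) + ((x - y) + w)
  ring = solve-∀

d-step : ∀ a k n → d a (suc k) (suc n) ≡ d a k (suc n) + d a (suc k) n
d-step a k n = trans (d-suc n a (suc k)) (trans (ring (b 0 (suc a) n) (Σ< (e ∘ suc) a n) (e 0 n) (d a (suc k) n) (Σ< (d a) (suc k) n))
  (cong (λ t → t + d a (suc k) n) (sym (d-suc n a k))))
  where
  ring : ∀ p q r x s → p + (q + (r + (x + s))) ≡ (p + (q + (r + s))) + x
  ring = solve-∀

c-step : ∀ a k n → c a (suc k) (suc n) ≡ c a k (suc n) + ((c a (suc k) n - c a k n) + d a k n)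
c-step a k n = trans (c-suc n a (suc k)) (trans (ring (b 0 (suc a) n) (Σ< (e ∘ suc) a n) (m 0 n) (c a (suc k) n) (c a k n) (d a k n) (Σ< (d a) k n))
  (cong (λ t → t + ((c a (suc k) n - c a k n) + d a k n)) (sym (c-suc n a k))))
  where
  ring : ∀ p q r x y w s → p + (q + (r + (x + (w + s)))) ≡ (p + (q + (r + (y + s)))) + ((x - y) + w)
  ring = solve-∀

-- The children B 0 (a+1) and M j do not depend on k and cancel. What remains advances a together
-- with the generation, the form that `telescope` consumes, with κ = 0 since all counts start at 1.
b-step : ∀ a k n → b a (suc k) (suc n) - b a k (suc n) ≡ c a k n + (b (suc a) (suc k) n - b (suc a) k n)
b-step a k n = trans (cong₂ _-_ (b-suc n a (suc k)) (b-suc n a k))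
  (ring (b 0 (suc a) n) (Σ< m a n) (b (suc a) (suc k) n) (b (suc a) k n) (c a k n) (Σ< (c a) k n))
  where
  ring : ∀ p q x y w s → (p + (q + (x + (w + s)))) - (p + (q + (y + s))) ≡ w + (x - y)
  ring = solve-∀

b-row : ∀ k n → b 0 (suc k) (suc n) ≡ b 0 k (suc n) + Diag (λ a → c a k) n
b-row k n = trans (ring (b 0 (suc k) (suc n)) (b 0 k (suc n)))
  (cong (λ t → b 0 k (suc n) + t)
    (trans (telescope (λ a n → b a (suc k) n - b a k n) (λ a → c a k) {+ 0} (λ _ → refl) (λ a → b-step a k) n) (+-identityʳ (Diag (λ a → c a k) n))))
  where
  ring : ∀ x y → x ≡ y + (x - y)
  ring = solve-∀

b-corner : ∀ n → b 0 0 (suc n) ≡ Diag (λ a n → b 0 (suc a) n + Σ< m a n) n + + 1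
b-corner = telescope (λ a → b a 0) (λ a n → b 0 (suc a) n + Σ< m a n) {+ 1} (λ _ → refl)
  λ a n → trans (b-suc n a 0) (ring (b 0 (suc a) n) (Σ< m a n) (b (suc a) 0 n))
  where
  ring : ∀ p q x → p + (q + (x + + 0)) ≡ (p + q) + x
  ring = solve-∀

-- The closed linear system

data Form : Set where
  var     : Fin 23 → Form
  _⊕_ _⊖_ : Form → Form → Form

infixl 6 _⊕_ _⊖_

-- A family and its shift appear together because the step of the shifted family involves their
-- difference. The diagonals of constant families are the partial sums of `m 0` and `e 0`, produced
-- by children that do not depend on a. The constant sequence absorbs the inhomogeneous terms, so
-- the system is linear and not just affine.
sequences : Vec (ℕ → ℤ) 23
sequences =
  z 0 ∷ Diag (z ∘ suc) ∷ Diag (λ k → z (2 ℕ.+ k)) ∷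
  b 0 0 ∷ b 0 1 ∷ Diag (λ k → b 0 (suc k)) ∷
  m 0 ∷ Diag m ∷ Diag (m ∘ suc) ∷ Diag (const (m 0)) ∷ Diag (Σ< m) ∷
  e 0 ∷ Diag e ∷ Diag (e ∘ suc) ∷ Diag (const (e 0)) ∷ Diag (Σ< (e ∘ suc)) ∷
  Diag (λ a → c a 0) ∷ Diag (λ k → Diag (λ a → c a k)) ∷ Diag (λ k → Diag (λ a → c a (suc k))) ∷
  Diag (λ a → d a 0) ∷ Diag (λ k → Diag (λ a → d a k)) ∷ Diag (λ k → Diag (λ a → d a (suc k))) ∷
  (λ _ → + 1) ∷ []

-- The sequences at n + 1 in terms of those at n, in the same order; a hat stands for Diag and a
-- prime for the value at n + 1.
rows : Vec Form 23
rows =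
  z₀′ ∷ ẑ₁′ ∷ ẑ₁′ ⊕ ẑ₂ ∷
  b₀′ ∷ b₀′ ⊕ ĉ₀ ∷ b₀′ ⊕ b̂ ⊕ ĉ ∷
  m₀′ ∷ m₀′ ⊕ m̂₁ ∷ m₀′ ⊕ m̂₁ ⊕ (m̂₁ ⊖ m̂ ⊕ ẑ₂) ∷ m₀′ ⊕ m̂₀ ∷ m̂ ⊕ Σm ∷
  e₀′ ∷ e₀′ ⊕ ê₁ ∷ e₀′ ⊕ ê₁ ⊕ (ê₁ ⊖ ê ⊕ ẑ₁) ∷ e₀′ ⊕ ê₀ ∷ ê₁ ⊕ Σe ∷
  ĉ₀′ ∷ ĉ₀′ ⊕ ĉ₁ ∷ ĉ₀′ ⊕ ĉ₁ ⊕ (ĉ₁ ⊖ ĉ ⊕ d̂) ∷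
  d̂₀′ ∷ d̂₀′ ⊕ d̂₁ ∷ d̂₀′ ⊕ d̂₁ ⊕ d̂₁ ∷
  one ∷ []
  where
  ẑ₁ = var (# 1) ; ẑ₂ = var (# 2)
  b₀ = var (# 3) ; b₁ = var (# 4) ; b̂ = var (# 5)
  m₀ = var (# 6) ; m̂ = var (# 7) ; m̂₁ = var (# 8) ; m̂₀ = var (# 9) ; Σm = var (# 10)
  e₀ = var (# 11) ; ê = var (# 12) ; ê₁ = var (# 13) ; ê₀ = var (# 14) ; Σe = var (# 15)
  ĉ₀ = var (# 16) ; ĉ = var (# 17) ; ĉ₁ = var (# 18)
  d̂₀ = var (# 19) ; d̂ = var (# 20) ; d̂₁ = var (# 21)
  one = var (# 22)
  z₀′ = b₀
  ẑ₁′ = z₀′ ⊕ ẑ₁ ⊕ ẑ₁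
  b₀′ = b̂ ⊕ Σm ⊕ one
  m₀′ = b₁ ⊕ (m₀ ⊕ m₀)
  e₀′ = b₁ ⊕ e₀
  ĉ₀′ = b̂ ⊕ (Σe ⊕ (m̂₀ ⊕ ĉ₀)) ⊕ one
  d̂₀′ = b̂ ⊕ (Σe ⊕ (ê₀ ⊕ d̂₀)) ⊕ one

eval : Form → (Fin 23 → ℤ) → ℤ
eval (var i) v = v i
eval (f ⊕ g) v = eval f v + eval g v
eval (f ⊖ g) v = eval f v - eval g v

values : ℕ → Fin 23 → ℤ
values n i = lookup sequences i n

Step : (ℕ → ℤ) → Form → Set
Step s f = ∀ n → s (suc n) ≡ eval f (values n)

-- `Diag f (suc n)` unfolds to `f 0 (suc n) + Diag (f ∘ suc) n`; this brings the present value of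
-- the shifted family into its own recursion.
Diag-step : ∀ (f h : ℕ → ℕ → ℤ) n {t} → (∀ k → f (suc k) 0 ≡ f k 0) → (∀ k n → f (suc k) (suc n) ≡ f k (suc n) + h k n) →
            f 0 (suc n) ≡ t → Diag (f ∘ suc) (suc n) ≡ (t + Diag (f ∘ suc) n) + Diag h n
Diag-step f h n f₀ fₛ refl = Diag-suc (f ∘ suc) f h f₀ fₛ n

Diag-diff : ∀ (f g h : ℕ → ℕ → ℤ) n →
            Diag (λ k n → (f k n - g k n) + h k n) n ≡ (Diag f n - Diag g n) + Diag h n
Diag-diff f g h n = trans (Diag-+ (λ k n → f k n - g k n) h n) (cong (λ t → t + Diag h n) (Diag-- f g n))

Diag-step-diff : ∀ (f h : ℕ → ℕ → ℤ) n {t} → (∀ k → f (suc k) 0 ≡ f k 0) →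
                 (∀ k n → f (suc k) (suc n) ≡ f k (suc n) + ((f (suc k) n - f k n) + h k n)) →
                 f 0 (suc n) ≡ t →
                 Diag (f ∘ suc) (suc n) ≡ (t + Diag (f ∘ suc) n) + ((Diag (f ∘ suc) n - Diag f n) + Diag h n)
Diag-step-diff f h n {t} f₀ fₛ eq =
  trans (Diag-step f (λ k n → (f (suc k) n - f k n) + h k n) n f₀ fₛ eq)
        (cong (λ u → (t + Diag (f ∘ suc) n) + u) (Diag-diff (f ∘ suc) f h n))

module _ (n : ℕ) where

  z₀-suc : z 0 (suc n) ≡ b 0 0 n
  z₀-suc = +-identityʳ (b 0 0 n)

  ẑ₁-suc : Diag (z ∘ suc) (suc n) ≡ (b 0 0 n + Diag (z ∘ suc) n) + Diag (z ∘ suc) n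
  ẑ₁-suc = Diag-step z (z ∘ suc) n (λ _ → refl) z-step z₀-suc

  ẑ₂-suc : Diag (λ k → z (2 ℕ.+ k)) (suc n) ≡ ((b 0 0 n + Diag (z ∘ suc) n) + Diag (z ∘ suc) n) + Diag (λ k → z (2 ℕ.+ k)) n
  ẑ₂-suc = trans (Diag-suc (λ k → z (2 ℕ.+ k)) (z ∘ suc) (λ k → z (2 ℕ.+ k)) (λ _ → refl) (z-step ∘ suc) n)
                 (cong (λ t → t + Diag (λ k → z (2 ℕ.+ k)) n) ẑ₁-suc)

  b₀-suc : b 0 0 (suc n) ≡ (Diag (λ k → b 0 (suc k)) n + Diag (Σ< m) n) + + 1
  b₀-suc = trans (b-corner n) (cong (λ t → t + + 1) (Diag-+ (λ k → b 0 (suc k)) (Σ< m) n))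

  m₀-suc : m 0 (suc n) ≡ b 0 1 n + (m 0 n + m 0 n)
  m₀-suc = trans (m-suc n 0) (cong (λ t → b 0 1 n + (m 0 n + t)) (+-identityˡ (m 0 n)))

  e₀-suc : e 0 (suc n) ≡ b 0 1 n + e 0 n
  e₀-suc = trans (e-suc n 0) (cong (λ t → b 0 1 n + t) (+-identityʳ (e 0 n)))

  Diag-four : ∀ (f g h k : ℕ → ℕ → ℤ) → Diag (λ a n → f a n + (g a n + (h a n + (k a n + + 0)))) n ≡
              Diag f n + (Diag g n + (Diag h n + Diag k n))
  Diag-four f g h k =
    trans (Diag-+ f (λ a n → g a n + (h a n + (k a n + + 0))) n) (cong (λ t → Diag f n + t)
      (trans (Diag-+ g (λ a n → h a n + (k a n + + 0)) n) (cong (λ t → Diag g n + t)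
        (trans (Diag-+ h (λ a n → k a n + + 0) n) (cong (λ t → Diag h n + t)
          (Diag-cong (λ a n → +-identityʳ (k a n)) n))))))

  ĉ₀-suc : Diag (λ a → c a 0) (suc n) ≡
           (Diag (λ k → b 0 (suc k)) n + (Diag (Σ< (e ∘ suc)) n + (Diag (const (m 0)) n + Diag (λ a → c a 0) n))) + + 1
  ĉ₀-suc = trans (Diag-suc-one (λ a → c a 0) (λ a n → b 0 (suc a) n + (Σ< (e ∘ suc) a n + (m 0 n + (c a 0 n + + 0)))) (λ _ → refl) (λ a n → c-suc n a 0) n)
    (cong (λ t → t + + 1) (Diag-four (λ k → b 0 (suc k)) (Σ< (e ∘ suc)) (const (m 0)) (λ a → c a 0)))

  d̂₀-suc : Diag (λ a → d a 0) (suc n) ≡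
           (Diag (λ k → b 0 (suc k)) n + (Diag (Σ< (e ∘ suc)) n + (Diag (const (e 0)) n + Diag (λ a → d a 0) n))) + + 1
  d̂₀-suc = trans (Diag-suc-one (λ a → d a 0) (λ a n → b 0 (suc a) n + (Σ< (e ∘ suc) a n + (e 0 n + (d a 0 n + + 0)))) (λ _ → refl) (λ a n → d-suc n a 0) n)
    (cong (λ t → t + + 1) (Diag-four (λ k → b 0 (suc k)) (Σ< (e ∘ suc)) (const (e 0)) (λ a → d a 0)))

-- `c-step` and `d-step` are uniform in a, so summing over a first leaves families in k of the kind
-- already treated.
Ĉ D̂ : ℕ → ℕ → ℤ
Ĉ k = Diag (λ a → c a k)
D̂ k = Diag (λ a → d a k)

Ĉ-step : ∀ k n → Ĉ (suc k) (suc n) ≡ Ĉ k (suc n) + ((Ĉ (suc k) n - Ĉ k n) + D̂ k n)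
Ĉ-step k n = trans (Diag-suc (λ a → c a (suc k)) (λ a → c a k)
                (λ a n → (c a (suc k) n - c a k n) + d a k n) (λ _ → refl) (λ a → c-step a k) n)
  (cong (λ t → Ĉ k (suc n) + t) (Diag-diff (λ a → c a (suc k)) (λ a → c a k) (λ a → d a k) n))

D̂-step : ∀ k n → D̂ (suc k) (suc n) ≡ D̂ k (suc n) + D̂ (suc k) n
D̂-step k = Diag-suc (λ a → d a (suc k)) (λ a → d a k) (λ a → d a (suc k)) (λ _ → refl) (λ a → d-step a k)

steps : Pointwise Step sequences rows
steps =
  z₀-suc ∷ ẑ₁-suc ∷ ẑ₂-suc ∷
  b₀-suc ∷
  (λ n → trans (b-row 0 n) (cong (λ t → t + Ĉ 0 n) (b₀-suc n))) ∷
  (λ n → Diag-step (b 0) Ĉ n (λ _ → refl) b-row (b₀-suc n)) ∷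
  m₀-suc ∷
  (λ n → cong (λ t → t + Diag (m ∘ suc) n) (m₀-suc n)) ∷
  (λ n → Diag-step-diff m (λ k → z (2 ℕ.+ k)) n (λ _ → refl) m-step (m₀-suc n)) ∷
  (λ n → cong (λ t → t + Diag (const (m 0)) n) (m₀-suc n)) ∷
  -- The empty sum at index 0 contributes nothing, so the diagonal at n + 1 is that of the shifted
  -- partial sums at n.
  (λ n → trans (+-identityˡ (Diag (Σ< m ∘ suc) n)) (Diag-+ m (Σ< m) n)) ∷
  e₀-suc ∷
  (λ n → cong (λ t → t + Diag (e ∘ suc) n) (e₀-suc n)) ∷
  (λ n → Diag-step-diff e (z ∘ suc) n (λ _ → refl) e-step (e₀-suc n)) ∷
  (λ n → cong (λ t → t + Diag (const (e 0)) n) (e₀-suc n)) ∷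
  (λ n → trans (+-identityˡ (Diag (Σ< (e ∘ suc) ∘ suc) n)) (Diag-+ (e ∘ suc) (Σ< (e ∘ suc)) n)) ∷
  ĉ₀-suc ∷
  (λ n → cong (λ t → t + Diag (Ĉ ∘ suc) n) (ĉ₀-suc n)) ∷
  (λ n → Diag-step-diff Ĉ D̂ n (λ _ → refl) Ĉ-step (ĉ₀-suc n)) ∷
  d̂₀-suc ∷
  (λ n → cong (λ t → t + Diag (D̂ ∘ suc) n) (d̂₀-suc n)) ∷
  (λ n → Diag-step D̂ (D̂ ∘ suc) n (λ _ → refl) D̂-step (d̂₀-suc n)) ∷
  (λ n → refl) ∷ []

-- Linear functionals on the 23 sequences

dot : ∀ {k} → Vec ℤ k → (Fin k → ℤ) → ℤ
dot []      v = + 0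
dot (x ∷ y) v = x * v F.zero + dot y (v ∘ F.suc)

unit : ∀ {k} → Fin k → Vec ℤ k
unit F.zero    = + 1 ∷ Vec.replicate _ (+ 0)
unit (F.suc i) = + 0 ∷ unit i

scale : ∀ {k} → ℤ → Vec ℤ k → Vec ℤ k
scale x = Vec.map (x *_)

dot-zero : ∀ k (v : Fin k → ℤ) → dot (Vec.replicate k (+ 0)) v ≡ + 0
dot-zero zero    v = refl
dot-zero (suc k) v = trans (cong₂ _+_ (ℤ.*-zeroˡ (v F.zero)) (dot-zero k (v ∘ F.suc))) refl

dot-unit : ∀ {k} (i : Fin k) v → dot (unit i) v ≡ v i
dot-unit {suc k} F.zero v = trans (cong₂ _+_ (ℤ.*-identityˡ (v F.zero)) (dot-zero k (v ∘ F.suc))) (+-identityʳ (v F.zero))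
dot-unit (F.suc i) v = trans (cong₂ _+_ (ℤ.*-zeroˡ (v F.zero)) (dot-unit i (v ∘ F.suc))) (+-identityˡ (v (F.suc i)))

dot-+ : ∀ {k} (x y : Vec ℤ k) v → dot (zipWith _+_ x y) v ≡ dot x v + dot y v
dot-+ []      []      v = refl
dot-+ (a ∷ x) (b ∷ y) v = trans (cong (λ t → (a + b) * v F.zero + t) (dot-+ x y (v ∘ F.suc)))
  (ring a b (v F.zero) (dot x (v ∘ F.suc)) (dot y (v ∘ F.suc)))
  where
  ring : ∀ a b v s t → (a + b) * v + (s + t) ≡ (a * v + s) + (b * v + t)
  ring = solve-∀

dot-- : ∀ {k} (x y : Vec ℤ k) v → dot (zipWith _-_ x y) v ≡ dot x v - dot y v
dot-- []      []      v = refl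
dot-- (a ∷ x) (b ∷ y) v = trans (cong (λ t → (a - b) * v F.zero + t) (dot-- x y (v ∘ F.suc)))
  (ring a b (v F.zero) (dot x (v ∘ F.suc)) (dot y (v ∘ F.suc)))
  where
  ring : ∀ a b v s t → (a - b) * v + (s - t) ≡ (a * v + s) - (b * v + t)
  ring = solve-∀

dot-scale : ∀ {k} a (x : Vec ℤ k) v → dot (scale a x) v ≡ a * dot x v
dot-scale a []      v = sym (ℤ.*-zeroʳ a)
dot-scale a (b ∷ x) v = trans (cong (λ t → a * b * v F.zero + t) (dot-scale a x (v ∘ F.suc)))
  (ring a b (v F.zero) (dot x (v ∘ F.suc)))
  where
  ring : ∀ a b v s → a * b * v + a * s ≡ a * (b * v + s)
  ring = solve-∀

-- This is what the syntax `Form` is for: the same rows are evaluated at the sequences and turned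
-- into integer vectors on which identities can be decided.
coefficients : Form → Vec ℤ 23
coefficients (var i) = unit i
coefficients (f ⊕ g) = zipWith _+_ (coefficients f) (coefficients g)
coefficients (f ⊖ g) = zipWith _-_ (coefficients f) (coefficients g)

dot-coefficients : ∀ f v → dot (coefficients f) v ≡ eval f v
dot-coefficients (var i) v = dot-unit i v
dot-coefficients (f ⊕ g) v = trans (dot-+ (coefficients f) _ v) (cong₂ _+_ (dot-coefficients f v) (dot-coefficients g v))
dot-coefficients (f ⊖ g) v = trans (dot-- (coefficients f) _ v) (cong₂ _-_ (dot-coefficients f v) (dot-coefficients g v))

-- The transpose of the transition matrix, applied to a functional: evaluation one generation later
-- becomes evaluation now.
pullback : ∀ {k} → Vec Form k → Vec ℤ k → Vec ℤ 23
pullback []       []      = Vec.replicate 23 (+ 0)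
pullback (f ∷ fs) (a ∷ y) = zipWith _+_ (scale a (coefficients f)) (pullback fs y)

dot-pullback : ∀ {k} {ss : Vec (ℕ → ℤ) k} {fs : Vec Form k} → Pointwise Step ss fs → ∀ y n →
               dot y (λ i → lookup ss i (suc n)) ≡ dot (pullback fs y) (values n)
dot-pullback [] [] n = sym (dot-zero 23 (values n))
dot-pullback {ss = s ∷ ss} {f ∷ fs} (st ∷ sts) (a ∷ y) n = begin
  a * s (suc n) + dot y (λ i → lookup ss i (suc n))
    ≡⟨ cong₂ (λ t u → a * t + u) (trans (st n) (sym (dot-coefficients f (values n)))) (dot-pullback sts y n) ⟩
  a * dot (coefficients f) (values n) + dot (pullback fs y) (values n)
    ≡⟨ cong (λ t → t + dot (pullback fs y) (values n)) (dot-scale a (coefficients f) (values n)) ⟨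
  dot (scale a (coefficients f)) (values n) + dot (pullback fs y) (values n)
    ≡⟨ dot-+ (scale a (coefficients f)) (pullback fs y) (values n) ⟨
  dot (pullback (f ∷ fs) (a ∷ y)) (values n) ∎
  where open ≡-Reasoning

-- The first row of the k-th power of the transition matrix.
shift : ℕ → Vec ℤ 23
shift zero    = unit (# 0)
shift (suc k) = pullback rows (shift k)

dot-shift : ∀ k n → z 0 (k ℕ.+ n) ≡ dot (shift k) (values n)
dot-shift zero    n = sym (dot-unit (# 0) (values n))
dot-shift (suc k) n = trans (cong (z 0) (sym (ℕ.+-suc k n))) (trans (dot-shift k (suc n)) (dot-pullback steps (shift k) n))

-- Convolution with polynomials and the final identity

sumTo-cong : ∀ n {f g} → (∀ k → k ℕ.≤ n → f k ≡ g k) → sumTo n f ≡ sumTo n g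
sumTo-cong zero    eq = eq 0 z≤n
sumTo-cong (suc n) eq = cong₂ _+_ (sumTo-cong n λ k k≤n → eq k (ℕ.m≤n⇒m≤1+n k≤n)) (eq (suc n) ℕ.≤-refl)

⊛-congʳ : ∀ f {g h : Series} → (∀ n → g n ≡ h n) → ∀ n → (f ⊛ g) n ≡ (f ⊛ h) n
⊛-congʳ f eq n = sumTo-cong n λ k _ → cong (λ t → f k * t) (eq (n ∸ k))

Degree≤ : ℕ → Series → Set
Degree≤ d f = ∀ n → d ℕ.< n → f n ≡ + 0

sumTo-zero : ∀ n {f} → (∀ k → k ℕ.≤ n → f k ≡ + 0) → sumTo n f ≡ + 0
sumTo-zero zero    f₀ = f₀ 0 z≤n
sumTo-zero (suc n) f₀ = cong₂ _+_ (sumTo-zero n λ k k≤n → f₀ k (ℕ.m≤n⇒m≤1+n k≤n)) (f₀ (suc n) ℕ.≤-refl)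

⊛-degree : ∀ {i j f g} → Degree≤ i f → Degree≤ j g → Degree≤ (i ℕ.+ j) (f ⊛ g)
⊛-degree {i} {j} {f} {g} df dg n i+j<n = sumTo-zero n term
  where
  term : ∀ k → k ℕ.≤ n → f k * g (n ∸ k) ≡ + 0
  term k k≤n with i ℕ.<? k
  ... | yes i<k = trans (cong (_* g (n ∸ k)) (df k i<k)) (ℤ.*-zeroˡ (g (n ∸ k)))
  ... | no  i≮k = trans (cong (f k *_) (dg (n ∸ k) j<n∸k)) (ℤ.*-zeroʳ (f k))
    where
    j<n∸k : j ℕ.< n ∸ k
    j<n∸k = ℕ.m+n≤o⇒m≤o∸n (suc j) (ℕ.≤-trans (ℕ.+-monoʳ-≤ (suc j) (ℕ.≮⇒≥ i≮k)) (ℕ.≤-trans (ℕ.≤-reflexive (cong suc (ℕ.+-comm j i))) i+j<n))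

poly-degree : ∀ c cs → Degree≤ (length cs) (poly (c ∷ cs))
poly-degree c []        (suc n) _         = refl
poly-degree c (c′ ∷ cs) (suc n) (s≤s l<n) = poly-degree c′ cs n l<n

pow-degree : ∀ {f} → Degree≤ 1 f → ∀ k → Degree≤ k (pow f k)
pow-degree df zero    = poly-degree (+ 1) []
pow-degree df (suc k) = ⊛-degree df (pow-degree df k)

numer-degree : Degree≤ 8 numer
numer-degree = ⊛-degree {4} {4} (pow-degree (poly-degree _ _) 4) (poly-degree _ _)

denom-degree : Degree≤ 8 denom
denom-degree = poly-degree _ _

sumTo-tail : ∀ d h j → (∀ k → d ℕ.< k → h k ≡ + 0) → sumTo (j ℕ.+ d) h ≡ sumTo d h
sumTo-tail d h zero    _  = refl
sumTo-tail d h (suc j) h₀ = trans (cong₂ _+_ (sumTo-tail d h j h₀) (h₀ (suc (j ℕ.+ d)) (s≤s (ℕ.m≤n+m d j)))) (+-identityʳ (sumTo d h))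

sumVec : ℕ → (ℕ → Vec ℤ 23) → Vec ℤ 23
sumVec zero    y = y 0
sumVec (suc n) y = zipWith _+_ (sumVec n y) (y (suc n))

dot-sumVec : ∀ n y v → dot (sumVec n y) v ≡ sumTo n (λ k → dot (y k) v)
dot-sumVec zero    y v = refl
dot-sumVec (suc n) y v = trans (dot-+ (sumVec n y) (y (suc n)) v) (cong (λ t → t + dot (y (suc n)) v) (dot-sumVec n y v))

-- The system is larger than the degree 8 of denom requires: the defect functional only vanishes
-- identically after three further steps, whence 11.
recurrence : ∀ n → (denom ⊛ z 0) (11 ℕ.+ n) ≡ + 0
recurrence n = begin
  sumTo (11 ℕ.+ n) term
    ≡⟨ cong (λ i → sumTo i term) (ℕ.+-comm 11 n) ⟩
  sumTo (n ℕ.+ 11) term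
    ≡⟨ sumTo-tail 11 term n (λ k 11<k → trans (cong (_* z 0 ((11 ℕ.+ n) ∸ k)) (denom-degree k (ℕ.≤-trans (ℕ.m≤m+n 9 3) 11<k))) (ℤ.*-zeroˡ (z 0 ((11 ℕ.+ n) ∸ k)))) ⟩
  sumTo 11 term
    ≡⟨ sumTo-cong 11 shifted ⟩
  sumTo 11 (λ k → dot (scale (denom k) (shift (11 ∸ k))) (values n))
    ≡⟨ dot-sumVec 11 (λ k → scale (denom k) (shift (11 ∸ k))) (values n) ⟨
  dot (sumVec 11 (λ k → scale (denom k) (shift (11 ∸ k)))) (values n)
    ≡⟨ cong (λ y → dot y (values n)) annihilated ⟩
  dot (Vec.replicate 23 (+ 0)) (values n)
    ≡⟨ dot-zero 23 (values n) ⟩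
  + 0 ∎
  where
  open ≡-Reasoning
  term : ℕ → ℤ
  term k = denom k * z 0 ((11 ℕ.+ n) ∸ k)
  shifted : ∀ k → k ℕ.≤ 11 → term k ≡ dot (scale (denom k) (shift (11 ∸ k))) (values n)
  shifted k k≤11 = trans
    (cong (denom k *_) (trans (cong (z 0) (trans (cong (_∸ k) (ℕ.+-comm 11 n)) (trans (ℕ.+-∸-assoc n k≤11) (ℕ.+-comm n (11 ∸ k))))) (dot-shift (11 ∸ k) n)))
    (sym (dot-scale (denom k) (shift (11 ∸ k)) (values n)))
  -- An identity between concrete integer vectors in which n no longer occurs, so a single
  -- computation settles every n.
  annihilated : sumVec 11 (λ k → scale (denom k) (shift (11 ∸ k))) ≡ Vec.replicate 23 (+ 0)
  annihilated = from-yes (≡-dec ℤ._≟_ (sumVec 11 (λ k → scale (denom k) (shift (11 ∸ k)))) (Vec.replicate 23 (+ 0)))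

-- From 11 on both sides vanish. The values below are computed from the shape recursion, including 9
-- and 10, which lie beyond the degree of `numer` but before the range of `recurrence`.
denom⊛z : ∀ n → (denom ⊛ z 0) n ≡ numer n
denom⊛z 0 = from-yes ((denom ⊛ z 0) 0 ℤ.≟ numer 0)
denom⊛z 1 = from-yes ((denom ⊛ z 0) 1 ℤ.≟ numer 1)
denom⊛z 2 = from-yes ((denom ⊛ z 0) 2 ℤ.≟ numer 2)
denom⊛z 3 = from-yes ((denom ⊛ z 0) 3 ℤ.≟ numer 3)
denom⊛z 4 = from-yes ((denom ⊛ z 0) 4 ℤ.≟ numer 4)
denom⊛z 5 = from-yes ((denom ⊛ z 0) 5 ℤ.≟ numer 5)
denom⊛z 6 = from-yes ((denom ⊛ z 0) 6 ℤ.≟ numer 6)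
denom⊛z 7 = from-yes ((denom ⊛ z 0) 7 ℤ.≟ numer 7)
denom⊛z 8 = from-yes ((denom ⊛ z 0) 8 ℤ.≟ numer 8)
denom⊛z 9 = from-yes ((denom ⊛ z 0) 9 ℤ.≟ numer 9)
denom⊛z 10 = from-yes ((denom ⊛ z 0) 10 ℤ.≟ numer 10)
denom⊛z (suc (suc (suc (suc (suc (suc (suc (suc (suc (suc (suc n))))))))))) =
  trans (recurrence n) (sym (numer-degree (11 ℕ.+ n) (ℕ.m≤m+n 9 (2 ℕ.+ n))))

theorem3p49 : Σ (ℕ → ℕ) λ a →
    ((n : ℕ) → HasSize (InSnT n) (a n)) ×
    ((n : ℕ) → (denom ⊛ gf a) n ≡ numer n)
theorem3p49 =
  (λ n → length (level n)) , hasSize-level ,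
  λ n → trans (⊛-congʳ denom length-level n) (denom⊛z n)
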